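{- Let $\mathcal{R}$ be a term rewrite system with canonical parallel DT problem $\langle\mathit{PDT}(\mathcal{R}),\mathit{PDT}(\mathcal{R}),\mathcal{R}\rangle$. Then for all $n\in\mathbb{N}$, $$\mathrm{pirc}_{\mathcal{R}}(n)\;\leq\;\mathrm{irc}_{\langle\mathit{PDT}(\mathcal{R}),\,\mathit{PDT}(\mathcal{R}),\,\mathcal{R}\rangle}(n).$$ If $\Rightarrow_{\mathcal{R}}$ is confluent, then for all $n\in\mathbb{N}$, $$\mathrm{pirc}_{\mathcal{R}}(n)\;=\;\mathrm{irc}_{\langle\mathit{PDT}(\mathcal{R}),\,\mathit{PDT}(\mathcal{R}),\,\mathcal{R}\rangle}(n).$$
   Context: Terms and rewriting. $\mathcal{T}(\Sigma,\mathcal{V})$ is the set of first-order terms over a finite signature $\Sigma$ and variables $\mathcal{V}$. The size of a term is $|x|=1$ for $x\in\mathcal{V}$ and $|f(t_1,\ldots,t_n)|=1+\sum_i|t_i|$. Positions of a term are finite sequences of positive integers ($\varepsilon$ is the root); $t|_\pi$ is the subterm at position $\pi$, $t[s]_\pi$ is $t$ with that subterm replaced by $s$. The strict prefix order on positions is: $\tau > \pi$ iff $\tau = \pi.\pi'$ for some $\pi' \neq \varepsilon$. A term rewrite system (TRS) $\mathcal{R}$ is a finite set of rules $\ell \to r$ with $\ell,r$ terms, $\ell \notin \mathcal{V}$ and $\mathcal{V}(r) \subseteq \mathcal{V}(\ell)$ (where $\mathcal{V}(t)$ is the set of variables of $t$). $s \to_{\mathcal{R}} t$ iff $s|_\pi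 = \ell\sigma$ and $t = s[r\sigma]_\pi$ for some $\ell\to r\in\mathcal{R}$, position $\pi$ of $s$ and substitution $\sigma$; $\ell\sigma$ is the redex. It is an innermost redex if no proper subterm of it is a redex, and then the step is an innermost step, written $s \xrightarrow{\mathsf{i}}_{\mathcal{R}} t$. Defined symbols: $\Sigma_d=\{f \mid f(\ell_1,\ldots,\ell_n)\to r\in\mathcal{R}\}$; constructor symbols: $\Sigma_c=\Sigma\setminus\Sigma_d$. $\mathrm{Pos}_d(t)$ is the set of positions $\pi$ of $t$ with root symbol of $t|_\pi$ in $\Sigma_d$. A basic term is $f(t_1,\ldots,t_k)$ with $f \in\Sigma_d$ and all $t_i\in\mathcal{T}(\Sigma_c,\mathcal{V})$; $\mathcal{T}^{\mathcal{R}}_{\mathrm{basic}}$ is the set of basic terms for $\mathcal{R}$. Parallel-innermost rewriting $\Rightarrow_{\mathcal{R}}$ (all innermost redexes are rewritten simultaneously): $s \Rightarrow_{\mathcal{R}} t$ iff $s \xrightarrow{\mathsf{i}}{}^{+}_{\mathcal{R}} t$ and either (a) $s \xrightarrow{\mathsf{i}}_{\mathcal{R}} t$ with $s$ an innermost redex, or (b) $s=f(s_1,\ldots,s_n)$, $t=f(t_1,\ldots,t_n)$, and for all $1\le k\le n$ either $s_k\Rightarrow_{\mathcal{R}} t_k$ or $s_k=t_k$ is a normal form. A relation $\to$ is confluent iff $s\to^* t$ and $s\to^* u$ imply there is $v$ with $t\to^* v$ and $u\to^* v$. Derivation height: $\mathrm{dh}(t,\to)=\sup\{e \mid \exists t'.\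 t\to^e t'\}\in\mathbb{N}\cup\{\omega\}$, with value $\omega$ if $t$ starts an infinite $\to$-sequence; $\sup$ is the least upper bound in $\mathbb{N}\cup\{\omega\}$, $\sup\emptyset=0$. Parallel-innermost runtime complexity: $\mathrm{pirc}_{\mathcal{R}}(n)=\sup\{\mathrm{dh}(t,\Rightarrow_{\mathcal{R}})\mid t\in\mathcal{T}^{\mathcal{R}}_{\mathrm{basic}},\ |t|\le n\}$. Sharp terms: for every $f\in\Sigma_d$ introduce a fresh symbol $f^\sharp$ of the same arity. For $t=f(t_1,\ldots,t_n)$ with $f\in\Sigma_d$, $t^\sharp=f^\sharp(t_1,\ldots,t_n)$; for all other terms $t^\sharp=t$. $\mathcal{T}^\sharp=\{t^\sharp\mid t\in\mathcal{T}(\Sigma,\mathcal{V}),\ \mathrm{root}(t)\in\Sigma_d\}$. For each $n$ let $\mathsf{Com}_n$ be a fresh "compound" symbol of arity $n$. A dependency tuple (DT) is a rule $s^\sharp\to\mathsf{Com}_n(t_1^\sharp,\ldots,t_n^\sharp)$ with $s^\sharp,t_1^\sharp,\ldots,t_n^\sharp\in\mathcal{T}^\sharp$. Structural dependency chains: $\langle\pi_1,\ldots,\pi_k\rangle$ is a structural dependency chain for $t$ iff $\pi_1,\ldots,\pi_k\in\mathrm{Pos}_d(t)$ and $\pi_1>\cdots>\pi_k$. It is maximal iff $k=0$ and $\mathrm{Pos}_d(t)=\emptyset$, or $k>0$ and for all $\pi\in\mathrm{Pos}_d(t)$: $\pi\not>\pi_1$, and $\pi_1>\pi$ implies $\pi\in\{\pi_2,\ldots,\pi_k\}$.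 $\mathit{MSDC}(t)$ is the set of maximal structural dependency chains for $t$. Parallel dependency tuples: $\mathit{PDT}(\ell\to r)=\{\ell^\sharp\to\mathsf{Com}_k((r|_{\pi_1})^\sharp,\ldots,(r|_{\pi_k})^\sharp)\mid\langle\pi_1,\ldots,\pi_k\rangle\in\mathit{MSDC}(r)\}$ and $\mathit{PDT}(\mathcal{R})=\bigcup_{\ell\to r\in\mathcal{R}}\mathit{PDT}(\ell\to r)$. Chain trees: let $\mathcal{D}$ be a set of DTs. Let $T$ be a (possibly infinite) tree whose nodes are labelled with pairs $(q^\sharp\to\mathsf{Com}_n(w_1^\sharp,\ldots,w_n^\sharp)\mid\nu)$ of a DT from $\mathcal{D}$ and a substitution $\nu$, with root label $(s^\sharp\to\mathsf{Com}_e(\ldots)\mid\sigma)$. $T$ is a $(\mathcal{D},\mathcal{R})$-chain tree for $s^\sharp\sigma$ iff for every node, with label $(u^\sharp\to\mathsf{Com}_m(v_1^\sharp,\ldots,v_m^\sharp)\mid\mu)$: (i) $u^\sharp\mu$ is in normal form w.r.t. $\mathcal{R}$; (ii) if its children are labelled $(p_1^\sharp\to\mathsf{Com}_{m_1}(\ldots)\mid\delta_1),\ldots,(p_k^\sharp\to\mathsf{Com}_{m_k}(\ldots)\mid\delta_k)$, then there are pairwise different $i_1,\ldots,i_k\in\{1,\ldots,m\}$ with $v_{i_j}^\sharp\mu\xrightarrow{\mathsf{i}}{}^{*}_{\mathcal{R}}p_j^\sharp\delta_j$ for all $j\in\{1,\ldots,k\}$. Complexity of DT problems: a DT problem is a triple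 $\langle\mathcal{D},\mathcal{S},\mathcal{R}\rangle$ with $\mathcal{D}$ a set of DTs, $\mathcal{S}\subseteq\mathcal{D}$ and $\mathcal{R}$ a TRS. $|T|_{\mathcal{S}}\in\mathbb{N}\cup\{\omega\}$ is the number of nodes of $T$ labelled with a DT from $\mathcal{S}$, and $\mathit{Cplx}_{\langle\mathcal{D},\mathcal{S},\mathcal{R}\rangle}(s^\sharp)=\sup\{|T|_{\mathcal{S}}\mid T\text{ is a }(\mathcal{D},\mathcal{R})\text{ -chain tree for }s^\sharp\}$; it is $0$ for terms $s^\sharp$ that have no chain tree. Its complexity function is $\mathrm{irc}_{\langle\mathcal{D},\mathcal{S},\mathcal{R}\rangle}(n)=\sup\{\mathit{Cplx}_{\langle\mathcal{D},\mathcal{S},\mathcal{R}\rangle}(t^\sharp)\mid t\in\mathcal{T}^{\mathcal{R}}_{\mathrm{basic}},\ |t|\le n\}$. -}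

module Defs where

open import Data.Fin.Base using (Fin)
open import Data.Fin.Properties using (inj⇒≟)
open import Data.List.Base as List using (List; []; _∷_; _∷ʳ_; length)
open import Data.List.Membership.Propositional using (_∈_)
open import Data.List.Relation.Unary.All using (All)
open import Data.List.Relation.Unary.Any using (Any; any?)
open import Data.List.Relation.Unary.Linked using (Linked)
open import Data.List.Relation.Unary.Unique.Propositional using (Unique)
open import Data.Maybe.Base using (Maybe; just)
open import Data.Nat.Base using (ℕ; suc; _+_; _≤_; _<_)
open import Data.Nat.Properties using (_≤?_; ≤-antisym; ≰⇒>)
open import Data.Nat.Induction using (<-rec)
open import Data.Product.Base using (Σ; ∃; ∃-syntax; _×_; _,_; proj₂)
open import Data.Sum.Base using (_⊎_)
open import Data.Vec.Base using (Vec; []; _∷_; lookup; _[_]≔_)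
open import Function.Bundles using (_↔_)
open import Function.Properties.Inverse using (↔⇒↣)
open import Level using (0ℓ)
open import Relation.Binary.Core using (Rel)
open import Relation.Binary.Construct.Closure.ReflexiveTransitive using (Star)
open import Relation.Binary.Construct.Closure.Transitive using (TransClosure)
open import Relation.Binary.Definitions using (DecidableEquality)
open import Relation.Binary.PropositionalEquality using (_≡_; _≢_; refl)
open import Relation.Binary.Rewriting using (IsNormalForm)
open import Relation.Nullary using (¬_; Dec; yes; no; contradiction)
open import Relation.Nullary.Construct.Add.Supremum using (_⁺; ⊤⁺; [_])
open import Relation.Unary using (Pred; _⊆_)
import Relation.Binary.Construct.Add.Supremum.NonStrict as AddSup

------------------------------------------------------------------------
-- ℕ ∪ {ω} and suprema

ℕω : Set
ℕω = ℕ ⁺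

ω : ℕω
ω = ⊤⁺

open AddSup _≤_ public using (_≤⊤⁺; [_]; ≤⁺-antisym-≡) renaming (_≤⁺_ to _≤ω_)

UpperBound : Pred ℕω 0ℓ → Pred ℕω 0ℓ
UpperBound P u = ∀ v → P v → v ≤ω u

-- The least upper bound of an arbitrary subset of ℕ ∪ {ω} cannot be computed
-- constructively, so "s = sup P" is a relation.  Every P has at most one
-- supremum (sup-unique) and cannot fail to have one (¬¬sup-exists).
IsSup : Pred ℕω 0ℓ → Pred ℕω 0ℓ
IsSup P s = UpperBound P s × (∀ u → UpperBound P u → s ≤ω u)

sup-unique : ∀ {P s t} → IsSup P s → IsSup P t → s ≡ t
sup-unique (ub₁ , least₁) (ub₂ , least₂) =
  ≤⁺-antisym-≡ ≤-antisym (least₁ _ ub₂) (least₂ _ ub₁)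

¬¬sup-exists : ∀ P → ¬ ¬ ∃ (IsSup P)
¬¬sup-exists P none = none (ω , (λ v _ → v ≤⊤⁺) , ω-least)
  where
  unbounded : ∀ m → ¬ UpperBound P [ m ]
  unbounded = <-rec _ λ m rec ub → none ([ m ] , ub , λ where
    ⊤⁺    _   → _ ≤⊤⁺
    [ j ] ubⱼ → least m j (λ j<m → rec j<m ubⱼ))
    where
    least : ∀ m j → ¬ (j < m) → [ m ] ≤ω [ j ]
    least m j j≮m with m ≤? j
    ... | yes m≤j = [ m≤j ]
    ... | no  m≰j = contradiction (≰⇒> m≰j) j≮m
  ω-least : ∀ u → UpperBound P u → ω ≤ω u
  ω-least ⊤⁺    _  = _ ≤⊤⁺
  ω-least [ j ] ub = contradiction ub (unbounded j)

------------------------------------------------------------------------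
-- Terms

record Signature : Set₁ where
  field
    Sym   : Set
    arity : Sym → ℕ

record FiniteSignature : Set₁ where
  field
    signature : Signature
  open Signature signature public
  field
    finite : ∃[ k ] (Sym ↔ Fin k)

  _≟_ : DecidableEquality Sym
  _≟_ = inj⇒≟ (↔⇒↣ (proj₂ finite))

module Terms (𝔽 : Signature) (V : Set) where
  open Signature 𝔽

  data Term : Set where
    var : V → Term
    fun : (f : Sym) → Vec Term (arity f) → Term

  mutual
    size : Term → ℕ
    size (var _)    = 1
    size (fun _ ts) = suc (sizes ts)

    sizes : ∀ {n} → Vec Term n → ℕ
    sizes []       = 0
    sizes (t ∷ ts) = size t + sizes ts

  data _∈V_ (x : V) : Term → Set where
    here  : x ∈V var x
    there : ∀ {f ts} i → x ∈V lookup ts i → x ∈V fun f ts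

  IsVar : Term → Set
  IsVar t = ∃[ x ] t ≡ var x

  HasRoot : Sym → Term → Set
  HasRoot f t = ∃[ ts ] t ≡ fun f ts

  Subst : Set
  Subst = V → Term

  mutual
    _·_ : Term → Subst → Term
    var x    · σ = σ x
    fun f ts · σ = fun f (ts ·* σ)

    _·*_ : ∀ {n} → Vec Term n → Subst → Vec Term n
    []       ·* σ = []
    (t ∷ ts) ·* σ = (t · σ) ∷ (ts ·* σ)

  infixl 8 _·_ _·*_

  -- The positions of t.  Argument positions are counted from 0.
  data Pos : Term → Set where
    ε   : ∀ {t} → Pos t
    _◂_ : ∀ {f ts} (i : Fin (arity f)) → Pos (lookup ts i) → Pos (fun f ts)

  infixr 5 _◂_

  _∣_ : (t : Term) → Pos t → Term
  t        ∣ ε       = t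
  fun f ts ∣ (i ◂ π) = lookup ts i ∣ π

  infixl 7 _∣_

  _[_]at_ : (t : Term) → Term → Pos t → Term
  t        [ s ]at ε       = s
  fun f ts [ s ]at (i ◂ π) = fun f (ts [ i ]≔ (lookup ts i [ s ]at π))

  _∙_ : ∀ {t} (π : Pos t) → Pos (t ∣ π) → Pos t
  ε       ∙ π′ = π′
  (i ◂ π) ∙ π′ = i ◂ (π ∙ π′)

  _>ᵖ_ : ∀ {t} → Rel (Pos t) 0ℓ
  _>ᵖ_ {t} τ π = Σ (Pos (t ∣ π)) λ π′ → π′ ≢ ε × τ ≡ π ∙ π′

  infix 4 _>ᵖ_ _∈V_

------------------------------------------------------------------------
-- Rewriting

  record Rule : Set where
    constructor _⟶_
    field
      lhs rhs : Term

  WellFormed : Rule → Set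
  WellFormed (ℓ ⟶ r) = ¬ IsVar ℓ × (∀ x → x ∈V r → x ∈V ℓ)

  -- Rewriting makes sense for any finite set of rules.
  module Rewriting (R : List Rule) where

    Step : Rel Term 0ℓ
    Step s t = ∃[ ℓ ] ∃[ r ] (ℓ ⟶ r) ∈ R ×
      Σ (Pos s) λ π → ∃[ σ ] (s ∣ π ≡ ℓ · σ × t ≡ s [ r · σ ]at π)

    NF : Term → Set
    NF = IsNormalForm Step

    Redex : Term → Set
    Redex s = ∃[ ℓ ] ∃[ r ] (ℓ ⟶ r) ∈ R × ∃[ σ ] s ≡ ℓ · σ

    InnermostRedex : Term → Set
    InnermostRedex s = Redex s × (∀ (π : Pos s) → π ≢ ε → ¬ Redex (s ∣ π))

    _→ⁱ_ : Rel Term 0ℓ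
    s →ⁱ t = ∃[ ℓ ] ∃[ r ] (ℓ ⟶ r) ∈ R ×
      Σ (Pos s) λ π → ∃[ σ ]
        (s ∣ π ≡ ℓ · σ × t ≡ s [ r · σ ]at π × InnermostRedex (s ∣ π))

    infix 4 _→ⁱ_ _⇉_

    -- Parallel-innermost rewriting.
    data _⇉_ : Rel Term 0ℓ where
      redex : ∀ {s t} → TransClosure _→ⁱ_ s t →
              InnermostRedex s → s →ⁱ t → s ⇉ t
      args  : ∀ {f ss ts} → TransClosure _→ⁱ_ (fun f ss) (fun f ts) →
              (∀ k → (lookup ss k ⇉ lookup ts k) ⊎
                     (lookup ss k ≡ lookup ts k × NF (lookup ss k))) →
              fun f ss ⇉ fun f ts

------------------------------------------------------------------------
-- Derivation height

data Power {A : Set} (_⟶_ : Rel A 0ℓ) : ℕ → Rel A 0ℓ where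
  done : ∀ {t} → Power _⟶_ 0 t t
  step : ∀ {e s t u} → s ⟶ t → Power _⟶_ e t u → Power _⟶_ (suc e) s u

-- If t starts an infinite sequence then t ⟶^e t′ is possible for every e, so
-- the supremum is ω as required.
IsDh : {A : Set} → Rel A 0ℓ → A → Pred ℕω 0ℓ
IsDh _⟶_ t = IsSup λ v → ∃[ e ] ∃[ t′ ] (Power _⟶_ e t t′ × v ≡ [ e ])

------------------------------------------------------------------------
-- Term rewrite systems

record TRS (𝔽 : FiniteSignature) (V : Set) : Set where
  open Terms (FiniteSignature.signature 𝔽) V
  field
    rules      : List Rule
    wellFormed : All WellFormed rules

module _ {𝔽 : FiniteSignature} {V : Set} (𝓡 : TRS 𝔽 V) where
  open FiniteSignature 𝔽
  open Terms signature V
  open TRS 𝓡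
  open Rewriting rules

  Defined : Sym → Set
  Defined f = Any (λ ρ → HasRoot f (Rule.lhs ρ)) rules

  defined? : ∀ f → Dec (Defined f)
  defined? f = any? (λ ρ → hasRoot? (Rule.lhs ρ)) rules
    where
    hasRoot? : ∀ t → Dec (HasRoot f t)
    hasRoot? (var _) = no λ ()
    hasRoot? (fun g ts) with g ≟ f
    ... | yes refl = yes (ts , refl)
    ... | no  g≢f  = no λ { (_ , refl) → g≢f refl }

  DefinedRoot : Term → Set
  DefinedRoot t = ∃[ f ] (Defined f × HasRoot f t)

  data ConstructorTerm : Term → Set where
    var : ∀ x → ConstructorTerm (var x)
    fun : ∀ {f ts} → ¬ Defined f → (∀ i → ConstructorTerm (lookup ts i)) →
          ConstructorTerm (fun f ts)

  Basic : Term → Set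
  Basic t = ∃[ f ] ∃[ ts ] (Defined f ×
    (∀ i → ConstructorTerm (lookup ts i)) × t ≡ fun f ts)

  _⇉ᴿ_ : Rel Term 0ℓ
  _⇉ᴿ_ = _⇉_

  IsPirc : ℕ → Pred ℕω 0ℓ
  IsPirc n = IsSup λ v → ∃[ t ] (Basic t × size t ≤ n × IsDh _⇉_ t v)

------------------------------------------------------------------------
-- Sharp terms

  -- The irrelevant argument restricts f♯ to defined f without creating
  -- several copies of it.
  data Sym♯ : Set where
    plain : Sym → Sym♯
    sharp : (f : Sym) → .(Defined f) → Sym♯

  signature♯ : Signature
  signature♯ = record { Sym = Sym♯ ; arity = arity♯ }
    where
    arity♯ : Sym♯ → ℕ
    arity♯ (plain f)   = arity f
    arity♯ (sharp f _) = arity f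

  module T♯ = Terms signature♯ V

  mutual
    embed : Term → T♯.Term
    embed (var x)    = T♯.var x
    embed (fun f ts) = T♯.fun (plain f) (embeds ts)

    embeds : ∀ {n} → Vec Term n → Vec T♯.Term n
    embeds []       = []
    embeds (t ∷ ts) = embed t ∷ embeds ts

  _♯ : Term → T♯.Term
  var x ♯ = T♯.var x
  fun f ts ♯ with defined? f
  ... | yes d = T♯.fun (sharp f d) (embeds ts)
  ... | no  _ = T♯.fun (plain f) (embeds ts)

  SharpTerm : T♯.Term → Set
  SharpTerm u = ∃[ t ] (DefinedRoot t × u ≡ t ♯)

  -- The rules of 𝓡, read over the signature extended by the sharp symbols.
  rules♯ : List T♯.Rule
  rules♯ = List.map (λ ρ → embed (Rule.lhs ρ) T♯.⟶ embed (Rule.rhs ρ)) rules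

  module R♯ = T♯.Rewriting rules♯

------------------------------------------------------------------------
-- Dependency tuples

  -- The rule  source → Com_n(t₁, …, tₙ)  with  targets = t₁ ∷ … ∷ tₙ ∷ [].  As
  -- Com_n occurs nowhere else, it is not made a symbol of the term signature.
  record DT : Set where
    field
      source   : T♯.Term
      targets  : List T♯.Term
      .source♯  : SharpTerm source
      .targets♯ : All SharpTerm targets
  open DT

  Posᵈ : ∀ t → Pred (Pos t) 0ℓ
  Posᵈ t π = DefinedRoot (t ∣ π)

  StructuralDependencyChain : ∀ t → Pred (List (Pos t)) 0ℓ
  StructuralDependencyChain t πs = All (Posᵈ t) πs × Linked _>ᵖ_ πs

  Maximal : ∀ t → Pred (List (Pos t)) 0ℓ
  Maximal t []        = ∀ π → ¬ Posᵈ t π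
  Maximal t (π₁ ∷ πs) = ∀ π → Posᵈ t π → ¬ (π >ᵖ π₁) × (π₁ >ᵖ π → π ∈ πs)

  MSDC : ∀ t → Pred (List (Pos t)) 0ℓ
  MSDC t πs = StructuralDependencyChain t πs × Maximal t πs

  PDTRule : Rule → Pred DT 0ℓ
  PDTRule (ℓ ⟶ r) d = ∃[ πs ] (MSDC r πs ×
    source d ≡ ℓ ♯ × targets d ≡ List.map (λ π → (r ∣ π) ♯) πs)

  PDT : Pred DT 0ℓ
  PDT d = ∃[ ρ ] (ρ ∈ rules × PDTRule ρ d)

------------------------------------------------------------------------
-- Chain trees

  Label : Set
  Label = DT × T♯.Subst

  -- A possibly infinite labelled tree: a node is the list of child indices on
  -- the path leading to it from the root.  Child indices may have gaps.
  record Tree : Set where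
    field
      at     : List ℕ → Maybe Label
      root   : ∃[ a ] at [] ≡ just a
      closed : ∀ w j {a} → at (w ∷ʳ j) ≡ just a → ∃[ b ] at w ≡ just b
  open Tree

  record IsChainTree (𝒟 : Pred DT 0ℓ) (T : Tree) (s : T♯.Term) : Set where
    field
      startsAt : ∃[ d ] ∃[ σ ] (at T [] ≡ just (d , σ) × s ≡ source d T♯.· σ)
      labels   : ∀ w {d μ} → at T w ≡ just (d , μ) → 𝒟 d
      normal   : ∀ w {d μ} → at T w ≡ just (d , μ) → R♯.NF (source d T♯.· μ)
      children : ∀ w {d μ} → at T w ≡ just (d , μ) →
        Σ (∀ j {p δ} → at T (w ∷ʳ j) ≡ just (p , δ) → Fin (length (targets d)))
          λ ι →
            (∀ j j′ {p δ p′ δ′}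
               (e  : at T (w ∷ʳ j)  ≡ just (p , δ))
               (e′ : at T (w ∷ʳ j′) ≡ just (p′ , δ′)) →
               ι j e ≡ ι j′ e′ → j ≡ j′) ×
            (∀ j {p δ} (e : at T (w ∷ʳ j) ≡ just (p , δ)) →
               Star R♯._→ⁱ_ (List.lookup (targets d) (ι j e) T♯.· μ)
                            (source p T♯.· δ))

------------------------------------------------------------------------
-- Complexity of DT problems

  -- The number of nodes labelled with a DT from 𝒮 is the supremum of the sizes
  -- of the finite sets of such nodes.
  IsNodeCount : Pred DT 0ℓ → Tree → Pred ℕω 0ℓ
  IsNodeCount 𝒮 T = IsSup λ v → ∃[ ws ] (Unique ws ×
    All (λ w → ∃[ d ] ∃[ μ ] (at T w ≡ just (d , μ) × 𝒮 d)) ws ×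
    v ≡ [ length ws ])

  record DTProblem : Set₁ where
    constructor ⟨_,_,_⟩
    field
      𝒟   : Pred DT 0ℓ
      𝒮   : Pred DT 0ℓ
      𝒮⊆𝒟 : 𝒮 ⊆ 𝒟

  IsCplx : DTProblem → T♯.Term → Pred ℕω 0ℓ
  IsCplx ⟨ 𝒟 , 𝒮 , _ ⟩ s =
    IsSup λ v → ∃[ T ] (IsChainTree 𝒟 T s × IsNodeCount 𝒮 T v)

  IsIrc : DTProblem → ℕ → Pred ℕω 0ℓ
  IsIrc P n = IsSup λ v → ∃[ t ] (Basic t × size t ≤ n × IsCplx P (t ♯) v)

  canonical : DTProblem
  canonical = ⟨ PDT , PDT , (λ d∈PDT → d∈PDT) ⟩

{-# OPTIONS --safe #-}

-- Both sides are compared with one relation, Takes t m: evaluating t innermost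
-- contains a chain of dependent root steps of length m, where the steps below a root
-- may be chosen independently of the evaluation that makes the root a redex.
-- Along a node with rule ℓ → r such a chain runs through nested positions of r, which
-- can be chosen to form a maximal structural dependency chain; hence Takes counts
-- exactly the nodes of finite chain trees.  A parallel-innermost derivation of length e
-- always yields Takes t e.  Conversely, if ⇉ is confluent, an independent derivation
-- below a root can be continued to the very normal form that the root step needs, so
-- Takes t m yields a derivation of length at least m.
--
-- Suprema exist only classically, but ≤ω is decidable, so the argument may run inside
-- the double-negation monad.
module Submission where

open import Defs
open import Data.Fin.Base using (Fin; zero; suc; toℕ)
open import Data.Fin.Properties as Fin using (sequence; suc-injective)
open import Data.List.Base as List using (List; filter; []; _∷_; _∷ʳ_; _++_; length)
open import Data.List.Membership.Propositional using (_∈_)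
open import Data.List.Membership.Propositional.Properties
  using (∈-map⁺; ∈-map⁻; ∈-++⁺ˡ; ∈-++⁺ʳ)
open import Data.List.Properties
  using (map-++; map-∘; ++-identityʳ; ∷ʳ-++; length-map; length-++; filter-accept; filter-reject)
open import Data.List.Relation.Unary.All as All using (All; []; _∷_)
open import Data.List.Relation.Unary.All.Properties as All using ()
open import Data.List.Relation.Unary.AllPairs using ([]; _∷_)
open import Data.List.Relation.Unary.Any as Any using (here; there)
open import Data.List.Relation.Unary.Linked as Linked using (Linked; []; [-]; _∷_)
open import Data.List.Relation.Unary.Linked.Properties as Linked using ()
open import Data.List.Relation.Unary.Unique.Propositional using (Unique)
open import Data.List.Relation.Unary.Unique.Propositional.Properties as Unique using ()
open import Data.Maybe.Base using (Maybe; just; nothing)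
open import Data.Maybe.Properties as Maybe using (just-injective)
open import Data.Nat.Base using (ℕ; zero; suc; pred; _+_; _⊔_; _≤_; _<_; z≤n; s≤s; s≤s⁻¹)
open import Data.Nat.Properties as ℕ using ()
open import Data.Product.Base using (Σ; ∃; ∃-syntax; _×_; _,_; proj₁; proj₂; -,_)
open import Data.Sum.Base as Sum using (_⊎_; inj₁; inj₂)
open import Data.Unit.Base using (⊤; tt)
open import Data.Vec.Base using (Vec; []; _∷_; lookup; _[_]≔_; tabulate)
open import Data.Vec.Properties
  using (lookup∘update; lookup∘update′; tabulate∘lookup; tabulate-cong; lookup∘tabulate)
open import Effect.Monad using (RawMonad)
open import Function.Base using (_∘_; id; case_of_)
open import Level using (0ℓ)
open import Relation.Binary.Construct.Add.Supremum.NonStrict _≤_ using (≤⁺-trans; ≤⁺-dec)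
open import Relation.Binary.Construct.Closure.ReflexiveTransitive
  using (Star; ε; _◅_; _◅◅_; gmap)
open import Relation.Binary.Construct.Closure.Transitive using (TransClosure; [_]; _∷_)
open import Relation.Binary.Core using (Rel)
open import Relation.Binary.PropositionalEquality
  using (_≡_; _≢_; refl; sym; trans; cong; cong₂; subst; subst₂)
open import Relation.Binary.Rewriting using (Confluent)
open import Relation.Nullary using (¬_; Dec; yes; no; contradiction)
open import Relation.Nullary.Construct.Add.Supremum using (⊤⁺; [_])
open import Relation.Nullary.Decidable using (¬¬-excluded-middle; decidable-stable)
open import Relation.Nullary.Negation using (¬¬-Monad)

open RawMonad {0ℓ} ¬¬-Monad using (_>>=_; pure; rawApplicative)

-- Finite families and closures of relations.

all⊎any : ∀ {n} {A B : Fin n → Set} → (∀ i → A i ⊎ B i) → (∀ i → A i) ⊎ ∃ B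
all⊎any {zero}  _ = inj₁ λ ()
all⊎any {suc n} h with h zero | all⊎any (h ∘ suc)
... | inj₂ b | _            = inj₂ (zero , b)
... | inj₁ _ | inj₂ (i , b) = inj₂ (suc i , b)
... | inj₁ a | inj₁ as      = inj₁ λ { zero → a ; (suc i) → as i }

lookup-injective : ∀ {A : Set} {n} (xs ys : Vec A n) →
  (∀ i → lookup xs i ≡ lookup ys i) → xs ≡ ys
lookup-injective xs ys eq =
  trans (sym (tabulate∘lookup xs)) (trans (tabulate-cong eq) (tabulate∘lookup ys))

vecChoice : ∀ {A : Set} {n} {Q : Fin n → A → Set} → (∀ i → ∃ (Q i)) →
  ∃[ xs ] (∀ i → Q i (lookup xs i))
vecChoice {Q = Q} h =
  tabulate (proj₁ ∘ h) , λ i → subst (Q i) (sym (lookup∘tabulate (proj₁ ∘ h) i)) (proj₂ (h i))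

bounded : ∀ {n} (k : Fin n → ℕ) → ∃[ N ] (∀ i → k i ≤ N)
bounded {zero}  k = 0 , λ ()
bounded {suc n} k with bounded (k ∘ suc)
... | N , k≤N = k zero ⊔ N , λ where
  zero    → ℕ.m≤m⊔n (k zero) N
  (suc i) → ℕ.≤-trans (k≤N i) (ℕ.m≤n⊔m (k zero) N)

toStar : ∀ {A : Set} {_⟶_ : Rel A 0ℓ} {s t} → TransClosure _⟶_ s t → Star _⟶_ s t
toStar [ st ]     = st ◅ ε
toStar (st ∷ tu)  = st ◅ toStar tu

toPlus : ∀ {A : Set} {_⟶_ : Rel A 0ℓ} {s t u} → s ⟶ t → Star _⟶_ t u → TransClosure _⟶_ s u
toPlus st ε         = [ st ]
toPlus st (tu ◅ uv) = st ∷ toPlus tu uv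

uncons⁺ : ∀ {A : Set} {_⟶_ : Rel A 0ℓ} {s u} → TransClosure _⟶_ s u →
  ∃[ t ] (s ⟶ t × Star _⟶_ t u)
uncons⁺ [ st ]    = -, st , ε
uncons⁺ (st ∷ tu) = -, st , toStar tu

-- Terms and innermost rewriting over an arbitrary signature.

module TermProperties (𝔽 : Signature) (V : Set) where
  open Signature 𝔽
  open Terms 𝔽 V

  term-ind : (Q : Term → Set) → (∀ x → Q (var x)) →
    (∀ f ts → (∀ i → Q (lookup ts i)) → Q (fun f ts)) → ∀ t → Q t
  term-ind Q qvar qfun = go
    where
    mutual
      go : ∀ t → Q t
      go (var x)    = qvar x
      go (fun f ts) = qfun f ts (go* ts)

      go* : ∀ {n} (ts : Vec Term n) i → Q (lookup ts i)
      go* (t ∷ ts) zero    = go t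
      go* (t ∷ ts) (suc i) = go* ts i

  lookup-·* : ∀ {n} (ts : Vec Term n) σ i → lookup (ts ·* σ) i ≡ lookup ts i · σ
  lookup-·* (t ∷ ts) σ zero    = refl
  lookup-·* (t ∷ ts) σ (suc i) = lookup-·* ts σ i

  ∣-∙ : ∀ t (π : Pos t) π′ → t ∣ (π ∙ π′) ≡ t ∣ π ∣ π′
  ∣-∙ t          ε       π′ = refl
  ∣-∙ (fun f ts) (i ◂ π) π′ = ∣-∙ (lookup ts i) π π′

  ∈V-∣ : ∀ {x} t (π : Pos t) → x ∈V (t ∣ π) → x ∈V t
  ∈V-∣ t          ε       x∈ = x∈
  ∈V-∣ (fun f ts) (i ◂ π) x∈ = there i (∈V-∣ (lookup ts i) π x∈)

  module RewritingProperties (R : List Rule)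
    (nonVar : ∀ {ℓ r} → (ℓ ⟶ r) ∈ R → ¬ IsVar ℓ) where
    open Rewriting R

    -- Positions are replaced by recursion along the path to the contracted subterm, and `Q` records
    -- what is known of it: constantly `⊤` gives `Step`, `ArgsNF` gives `→ⁱ`. No left-hand side is a
    -- variable, so a `root` step always starts from some `fun f ss`.
    data Rewrite (Q : Term → Set) : Rel Term 0ℓ where
      root : ∀ {f ss ℓ r σ} → (ℓ ⟶ r) ∈ R → fun f ss ≡ ℓ · σ → Q (fun f ss) →
             Rewrite Q (fun f ss) (r · σ)
      arg  : ∀ {f ss t} i → Rewrite Q (lookup ss i) t →
             Rewrite Q (fun f ss) (fun f (ss [ i ]≔ t))

    ArgsNF : Term → Set
    ArgsNF (var _)    = ⊤
    ArgsNF (fun f ss) = ∀ i → NF (lookup ss i)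

    rewriteAt : ∀ {Q ℓ r σ} → (ℓ ⟶ r) ∈ R → ∀ s (π : Pos s) → s ∣ π ≡ ℓ · σ →
      Q (s ∣ π) → Rewrite Q s (s [ r · σ ]at π)
    rewriteAt {ℓ = var x}    ∈R _          _       _  _ = contradiction (x , refl) (nonVar ∈R)
    rewriteAt {ℓ = fun g ls} ∈R (var _)    ε       () _
    rewriteAt {ℓ = fun g ls} ∈R (fun f ss) ε       eq q = root ∈R eq q
    rewriteAt {ℓ = fun g ls} ∈R (fun f ss) (i ◂ π) eq q = arg i (rewriteAt ∈R (lookup ss i) π eq q)

    step⇒rewrite : ∀ {s t} → Step s t → Rewrite (λ _ → ⊤) s t
    step⇒rewrite (_ , _ , ∈R , π , _ , eq , refl) = rewriteAt ∈R _ π eq tt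

    rewrite⇒step : ∀ {s t} → Rewrite (λ _ → ⊤) s t → Step s t
    rewrite⇒step (root ∈R eq _) = -, -, ∈R , ε , -, eq , refl
    rewrite⇒step (arg i st) with rewrite⇒step st
    ... | _ , _ , ∈R , π , _ , eq , refl = -, -, ∈R , i ◂ π , -, eq , refl

    innermost⇒argsNF : ∀ {s} → InnermostRedex s → ArgsNF s
    innermost⇒argsNF {var _}    _ = tt
    innermost⇒argsNF {fun f ss} (_ , no-redex) i (_ , ℓ , r , ∈R , π , σ , eq , _) =
      no-redex (i ◂ π) (λ ()) (ℓ , r , ∈R , σ , eq)

    argsNF⇒innermost : ∀ {f ss} → Redex (fun f ss) → ArgsNF (fun f ss) → InnermostRedex (fun f ss)
    argsNF⇒innermost red nfs = red , λ where
      ε       π≢ε _ → π≢ε refl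
      (i ◂ π) _ (ℓ , r , ∈R , σ , eq) → nfs i (-, ℓ , r , ∈R , π , σ , eq , refl)

    →ⁱ⇒rewrite : ∀ {s t} → s →ⁱ t → Rewrite ArgsNF s t
    →ⁱ⇒rewrite (_ , _ , ∈R , π , _ , eq , refl , inn) =
      rewriteAt ∈R _ π eq (innermost⇒argsNF inn)

    →ⁱ-root : ∀ {f ss ℓ r σ} → (ℓ ⟶ r) ∈ R → fun f ss ≡ ℓ · σ →
      (∀ i → NF (lookup ss i)) → fun f ss →ⁱ r · σ
    →ⁱ-root ∈R eq nfs =
      -, -, ∈R , ε , -, eq , refl , argsNF⇒innermost (-, -, ∈R , -, eq) nfs

    →ⁱ-arg : ∀ {f ss t} i → lookup ss i →ⁱ t → fun f ss →ⁱ fun f (ss [ i ]≔ t)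
    →ⁱ-arg i (_ , _ , ∈R , π , _ , eq , refl , inn) =
      -, -, ∈R , i ◂ π , -, eq , refl , inn

    rewrite⇒→ⁱ : ∀ {s t} → Rewrite ArgsNF s t → s →ⁱ t
    rewrite⇒→ⁱ (root ∈R eq nfs) = →ⁱ-root ∈R eq nfs
    rewrite⇒→ⁱ (arg i st)       = →ⁱ-arg i (rewrite⇒→ⁱ st)

    →ⁱ⇒step : ∀ {s t} → s →ⁱ t → Step s t
    →ⁱ⇒step (ℓ , r , ∈R , π , σ , eq , t≡ , _) = ℓ , r , ∈R , π , σ , eq , t≡

    nf-no-→ⁱ⁺ : ∀ {s t} → NF s → ¬ TransClosure _→ⁱ_ s t
    nf-no-→ⁱ⁺ nf st = let _ , s→t , _ = uncons⁺ st in nf (-, →ⁱ⇒step s→t)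

    nf-arg : ∀ {f ss} → NF (fun f ss) → ∀ i → NF (lookup ss i)
    nf-arg nf i (_ , st) = nf (-, rewrite⇒step (arg i (step⇒rewrite st)))

    nf-fun : ∀ {f ss} → ¬ Redex (fun f ss) → (∀ i → NF (lookup ss i)) → NF (fun f ss)
    nf-fun no-redex nfs (_ , st) with step⇒rewrite st
    ... | root ∈R eq _ = no-redex (-, -, ∈R , -, eq)
    ... | arg i st′    = nfs i (-, rewrite⇒step st′)

    nf-no-redex : ∀ {s} → NF s → ¬ Redex s
    nf-no-redex nf (_ , _ , ∈R , _ , eq) = nf (-, -, -, ∈R , ε , -, eq , refl)

    nf-var : ∀ {x} → NF (var x)
    nf-var (_ , st) with step⇒rewrite st
    ... | ()

    nf-subst : ∀ {σ x} t → NF (t · σ) → x ∈V t → NF (σ x)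
    nf-subst (var _) nf here = nf
    nf-subst {σ} (fun f ts) nf (there i x∈) =
      nf-subst (lookup ts i) (subst NF (lookup-·* ts σ i) (nf-arg nf i)) x∈

    private
      _⇝_ : ∀ {n} → Rel (Vec Term n) 0ℓ
      ss ⇝ ts = ∃[ i ] ∃[ t ] (lookup ss i →ⁱ t × ts ≡ ss [ i ]≔ t)

      ⇝-all : ∀ {n} (ss ts : Vec Term n) →
        (∀ i → Star _→ⁱ_ (lookup ss i) (lookup ts i)) → Star _⇝_ ss ts
      ⇝-all []       []       _  = ε
      ⇝-all (s ∷ ss) (t ∷ ts) sts =
        gmap (_∷ ss) (λ st → zero , _ , st , refl) (sts zero) ◅◅
        gmap (t ∷_) (λ { (i , _ , st , refl) → suc i , _ , st , refl }) (⇝-all ss ts (sts ∘ suc))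

    →ⁱ*-args : ∀ {f ss ts} → (∀ i → Star _→ⁱ_ (lookup ss i) (lookup ts i)) →
      Star _→ⁱ_ (fun f ss) (fun f ts)
    →ⁱ*-args {f} sts =
      gmap (fun f) (λ { (i , _ , st , refl) → →ⁱ-arg i st }) (⇝-all _ _ sts)

    -- Splits off the first step of component k, so the rest is a plain →ⁱ*.
    →ⁱ⁺-args : ∀ {f ss ts} k → TransClosure _→ⁱ_ (lookup ss k) (lookup ts k) →
      (∀ i → Star _→ⁱ_ (lookup ss i) (lookup ts i)) →
      TransClosure _→ⁱ_ (fun f ss) (fun f ts)
    →ⁱ⁺-args {f} {ss} {ts} k st sts with uncons⁺ st
    ... | u , s→u , u→t = toPlus (→ⁱ-arg k s→u) (→ⁱ*-args rest)
      where
      rest : ∀ i → Star _→ⁱ_ (lookup (ss [ k ]≔ u) i) (lookup ts i)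
      rest i with i Fin.≟ k
      ... | yes refl rewrite lookup∘update k ss u = u→t
      ... | no  i≢k  rewrite lookup∘update′ i≢k ss u = sts i

-- The relation `Takes` bounds parallel-innermost derivations.

module ParallelTime (𝔽 : Signature) (V : Set)
  (R : List (Terms.Rule 𝔽 V))
  (nonVar : ∀ {ℓ r} → (ℓ Terms.⟶ r) ∈ R → ¬ Terms.IsVar 𝔽 V ℓ) where
  open Signature 𝔽
  open Terms 𝔽 V
  open Rewriting R
  open TermProperties 𝔽 V
  open RewritingProperties R nonVar

  -- Without confluence m may exceed the parallel-innermost time for t: the steps counted
  -- below the root need not belong to the evaluation ss →ⁱ* vs, exactly as the children
  -- of a chain tree node are independent of each other.
  mutual
    data Takes : Term → ℕ → Set where
      none  : ∀ {t} → Takes t 0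
      below : ∀ {f ss m} → ArgTakes ss m → Takes (fun f ss) m
      root  : ∀ {f ss vs a b ℓ r σ} →
        (∀ i → Star _→ⁱ_ (lookup ss i) (lookup vs i)) → (∀ i → NF (lookup vs i)) →
        (ℓ ⟶ r) ∈ R → fun f vs ≡ ℓ · σ →
        ArgTakes ss a → Takes (r · σ) b → Takes (fun f ss) (a + suc b)

    -- Arguments are evaluated simultaneously, so the count follows a single one of them instead of
    -- adding them up.
    data ArgTakes {n} (ss : Vec Term n) : ℕ → Set where
      none : ArgTakes ss 0
      at   : ∀ i {m} → Takes (lookup ss i) m → ArgTakes ss m

  mutual
    nf-takes : ∀ {t m} → NF t → Takes t m → m ≡ 0
    nf-takes nf none       = refl
    nf-takes nf (below as) = nfs-take (nf-arg nf) as
    nf-takes nf (root {ss = ss} {vs} sts nfs ∈R eq _ _)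
      with lookup-injective ss vs (λ i → nf-star (nf-arg nf i) (sts i))
    ... | refl = contradiction (-, -, ∈R , -, eq) (nf-no-redex nf)

    nfs-take : ∀ {n m} {ss : Vec Term n} → (∀ i → NF (lookup ss i)) → ArgTakes ss m → m ≡ 0
    nfs-take nfs none     = refl
    nfs-take nfs (at i p) = nf-takes (nfs i) p

    nf-star : ∀ {s t} → NF s → Star _→ⁱ_ s t → s ≡ t
    nf-star nf ε        = refl
    nf-star nf (st ◅ _) = contradiction (-, →ⁱ⇒step st) nf

  takes-subst : ∀ {σ m} r (π : Pos r) → Takes ((r ∣ π) · σ) m → Takes (r · σ) m
  takes-subst r ε p = p
  takes-subst {σ} {m} (fun f ts) (i ◂ π) p = below
    (at i (subst (λ t → Takes t m) (sym (lookup-·* ts σ i)) (takes-subst (lookup ts i) π p)))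

  mutual
    -- A step inside an argument is absorbed by the evaluation of the arguments that precedes the
    -- next root step. A root step would even raise the count by one, which `takes-pred` gives away.
    takes-expand : ∀ {s t m} → Rewrite ArgsNF s t → Takes t m → Takes s m
    takes-expand (root ∈R eq nfs) p = takes-pred (root (λ _ → ε) nfs ∈R eq none p)
    takes-expand (arg i st) none = none
    takes-expand (arg i st) (below as) = below (argTakes-expand i st as)
    takes-expand {s = fun f ss} (arg {t = t} i st) (root {vs = vs} sts nfs ∈R eq as p) =
      root sts′ nfs ∈R eq (argTakes-expand i st as) p
      where
      sts′ : ∀ j → Star _→ⁱ_ (lookup ss j) (lookup vs j)
      sts′ j with j Fin.≟ i | sts j
      ... | yes refl | st′ rewrite lookup∘update i ss t      = rewrite⇒→ⁱ st ◅ st′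
      ... | no  j≢i  | st′ rewrite lookup∘update′ j≢i ss t   = st′

    argTakes-expand : ∀ {n m t} {ss : Vec Term n} i → Rewrite ArgsNF (lookup ss i) t →
      ArgTakes (ss [ i ]≔ t) m → ArgTakes ss m
    argTakes-expand i st none = none
    argTakes-expand {t = t} {ss} i st (at j p) with j Fin.≟ i
    ... | yes refl rewrite lookup∘update i ss t    = at i (takes-expand st p)
    ... | no  j≢i  rewrite lookup∘update′ j≢i ss t = at j p

    takes-pred : ∀ {s m} → Takes s (suc m) → Takes s m
    takes-pred p = takes-pred′ p refl

    -- The index is a variable with an equation because `a + suc b` does not unify with `suc m`.
    takes-pred′ : ∀ {s m n} → Takes s n → n ≡ suc m → Takes s m
    takes-pred′ (below as) refl = below (argTakes-pred as refl)
    takes-pred′ (root {a = zero} {b = zero} sts nfs ∈R eq as p) refl = none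
    takes-pred′ (root {a = zero} {b = suc b} sts nfs ∈R eq as p) refl =
      root sts nfs ∈R eq none (takes-pred′ p refl)
    takes-pred′ (root {a = suc a} sts nfs ∈R eq as p) refl =
      root sts nfs ∈R eq (argTakes-pred as refl) p

    argTakes-pred : ∀ {n m k} {ss : Vec Term n} → ArgTakes ss k → k ≡ suc m → ArgTakes ss m
    argTakes-pred (at i p) eq = at i (takes-pred′ p eq)

  takes-expand* : ∀ {s t m} → Star _→ⁱ_ s t → Takes t m → Takes s m
  takes-expand* ε          p = p
  takes-expand* (st ◅ sts) p = takes-expand (→ⁱ⇒rewrite st) (takes-expand* sts p)

  ⇉⇒→ⁱ⁺ : ∀ {s t} → s ⇉ t → TransClosure _→ⁱ_ s t
  ⇉⇒→ⁱ⁺ (redex st _ _) = st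
  ⇉⇒→ⁱ⁺ (args st _)    = st

  Par : Rel Term 0ℓ
  Par s t = s ⇉ t ⊎ (s ≡ t × NF s)

  par⇒→ⁱ* : ∀ {s t} → Par s t → Star _→ⁱ_ s t
  par⇒→ⁱ* (inj₁ st)         = toStar (⇉⇒→ⁱ⁺ st)
  par⇒→ⁱ* (inj₂ (refl , _)) = ε

  mutual
    -- A contracted innermost redex becomes a new root step in front. Otherwise every argument that
    -- is not idle gains one by induction, and so does the count, whichever argument it runs
    -- through.
    takes-suc : ∀ {s t m} → s ⇉ t → Takes t m → Takes s (suc m)
    takes-suc (redex _ inn st) p with →ⁱ⇒rewrite st
    ... | root ∈R eq nfs = root (λ _ → ε) nfs ∈R eq none p
    ... | arg i st′      = contradiction (-, →ⁱ⇒step (rewrite⇒→ⁱ st′)) (innermost⇒argsNF inn i)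
    takes-suc (args {f} {ss} {ts} st h) p with all⊎any (λ k → Sum.swap (par-takes (h k) none))
    ... | inj₂ (k , q) = stepping (argTakes-suc h (at k q)) p
      where
      stepping : (∀ {m} → ArgTakes ts m → ArgTakes ss (suc m)) →
        ∀ {m} → Takes (fun f ts) m → Takes (fun f ss) (suc m)
      stepping lift none       = below (lift none)
      stepping lift (below as) = below (lift as)
      stepping lift (root sts nfs ∈R eq as p) =
        root (λ i → par⇒→ⁱ* (h i) ◅◅ sts i) nfs ∈R eq (lift as) p
    -- No argument moves, so this is a loop  fun f ss →ⁱ⁺ fun f ss  through the root.
    ... | inj₁ idle with lookup-injective ss ts (proj₁ ∘ idle)
    ... | refl with uncons⁺ st
    ... | _ , st₁ , sts with →ⁱ⇒rewrite st₁
    -- The count `p` starts at the end of the loop; it is pulled back to the contractum of the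
    -- loop's first step, and that first step adds the one.
    ... | root ∈R eq nfs = root (λ _ → ε) nfs ∈R eq none (takes-expand* sts p)
    ... | arg i st′      = contradiction (-, →ⁱ⇒step (rewrite⇒→ⁱ st′)) (proj₂ (idle i))

    -- If the counted argument is idle, it is a normal form and its count is 0; the result 1 then
    -- comes from `one`, which some moving argument provides.
    argTakes-suc : ∀ {n m} {ss ts : Vec Term n} → (∀ k → Par (lookup ss k) (lookup ts k)) →
      ArgTakes ss 1 → ArgTakes ts m → ArgTakes ss (suc m)
    argTakes-suc h one none = one
    argTakes-suc h one (at i p) with par-takes (h i) p
    ... | inj₁ q         = at i q
    ... | inj₂ (eq , nf) with nf-takes (subst NF eq nf) p
    ... | refl = one

    par-takes : ∀ {s t m} → Par s t → Takes t m → Takes s (suc m) ⊎ (s ≡ t × NF s)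
    par-takes (inj₁ st)   p = inj₁ (takes-suc st p)
    par-takes (inj₂ idle) _ = inj₂ idle

  power⇒takes : ∀ {e s t} → Power _⇉_ e s t → Takes s e
  power⇒takes done        = none
  power⇒takes (step st p) = takes-suc st (power⇒takes p)

-- From `Takes` to parallel-innermost derivations, under confluence.

module Synchronisation (𝔽 : Signature) (V : Set)
  (R : List (Terms.Rule 𝔽 V))
  (nonVar : ∀ {ℓ r} → (ℓ Terms.⟶ r) ∈ R → ¬ Terms.IsVar 𝔽 V ℓ) where
  open Signature 𝔽
  open Terms 𝔽 V
  open Rewriting R
  open TermProperties 𝔽 V
  open RewritingProperties R nonVar
  open ParallelTime 𝔽 V R nonVar

  private
    variable
      f : Sym
      s t u v : Term
      ss ts us vs : Vec Term (arity f)

  infix 4 _⇉[_]_ _⇓_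

  _⇉[_]_ : Term → ℕ → Term → Set
  s ⇉[ n ] t = Power _⇉_ n s t

  ⇉-root : ∀ {ℓ r σ} → (ℓ ⟶ r) ∈ R → fun f ss ≡ ℓ · σ →
    (∀ i → NF (lookup ss i)) → fun f ss ⇉ r · σ
  ⇉-root ∈R eq nfs = redex [ st ] (argsNF⇒innermost (-, -, ∈R , -, eq) nfs) st
    where st = →ⁱ-root ∈R eq nfs

  nf-no-⇉ : NF s → ¬ s ⇉ t
  nf-no-⇉ n st = nf-no-→ⁱ⁺ n (⇉⇒→ⁱ⁺ st)

  -- That argument `k` cannot idle provides the nonempty `→ⁱ`-sequence demanded by `args`.
  ⇉-args : ∀ {f ss ts} k → ¬ NF (lookup ss k) →
    (∀ i → Par (lookup ss i) (lookup ts i)) → fun f ss ⇉ fun f ts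
  ⇉-args k ¬nf h with h k in eq
  ... | inj₁ st      = args (→ⁱ⁺-args k (⇉⇒→ⁱ⁺ st) (par⇒→ⁱ* ∘ h)) h
  ... | inj₂ (_ , n) = contradiction n ¬nf

  -- Big-step innermost evaluation to a normal form. A sequence of `→ⁱ` interleaves steps in
  -- different arguments; here the evaluations of the arguments are separated, so that they can be
  -- run in parallel.
  data _⇓_ : Rel Term 0ℓ where
    nf   : NF v → v ⇓ v
    args : (∀ i → lookup ss i ⇓ lookup vs i) → NF (fun f vs) → fun f ss ⇓ fun f vs
    root : ∀ {ℓ r σ} → (∀ i → lookup ss i ⇓ lookup vs i) → (∀ i → NF (lookup vs i)) →
           (ℓ ⟶ r) ∈ R → fun f vs ≡ ℓ · σ → r · σ ⇓ v → fun f ss ⇓ v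

  ⇓-nf : s ⇓ v → NF v
  ⇓-nf (nf n)           = n
  ⇓-nf (args _ n)       = n
  ⇓-nf (root _ _ _ _ e) = ⇓-nf e

  mutual
    -- A root step has its arguments already in normal form and becomes a `root` node; a step in an
    -- argument is prepended to the evaluation of that argument.
    ⇓-expand : Rewrite ArgsNF s t → t ⇓ v → s ⇓ v
    ⇓-expand (root ∈R eq nfs) e               = root (nf ∘ nfs) nfs ∈R eq e
    ⇓-expand (arg {ss = ss} i st) (nf n) = args (⇓*-expand ss (ss [ i ]≔ _) i st (nf ∘ nf-arg n)) n
    ⇓-expand (arg {ss = ss} i st) (args {vs = vs} es n) = args (⇓*-expand ss vs i st es) n
    ⇓-expand (arg {ss = ss} i st) (root {vs = vs} es nfs ∈R eq e) =
      root (⇓*-expand ss vs i st es) nfs ∈R eq e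

    ⇓*-expand : ∀ {n} (ss vs : Vec Term n) i → Rewrite ArgsNF (lookup ss i) t →
      (∀ j → lookup (ss [ i ]≔ t) j ⇓ lookup vs j) → ∀ j → lookup ss j ⇓ lookup vs j
    ⇓*-expand {t = t} ss _ i st es j with j Fin.≟ i | es j
    ... | yes refl | e rewrite lookup∘update i ss t      = ⇓-expand st e
    ... | no  j≢i  | e rewrite lookup∘update′ j≢i ss t   = e

  →ⁱ*⇒⇓ : Star _→ⁱ_ s v → NF v → s ⇓ v
  →ⁱ*⇒⇓ ε          n = nf n
  →ⁱ*⇒⇓ (st ◅ sts) n = ⇓-expand (→ⁱ⇒rewrite st) (→ⁱ*⇒⇓ sts n)

  _++ᴾ_ : ∀ {m n} → s ⇉[ m ] t → t ⇉[ n ] u → s ⇉[ m + n ] u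
  done      ++ᴾ q = q
  step st p ++ᴾ q = step st (p ++ᴾ q)

  star⇒power : Star _⇉_ s t → ∃[ n ] s ⇉[ n ] t
  star⇒power ε          = -, done
  star⇒power (st ◅ sts) = -, step st (proj₂ (star⇒power sts))

  power⇒star : ∀ {n} → s ⇉[ n ] t → Star _⇉_ s t
  power⇒star done        = ε
  power⇒star (step st p) = st ◅ power⇒star p

  par-power : ∀ {n} → NF v → s ⇉[ n ] v → ∃[ t ] (Par s t × t ⇉[ pred n ] v)
  par-power n done        = -, inj₂ (refl , n) , done
  par-power n (step st p) = -, inj₁ st , p

  -- Arguments that have reached their normal form idle until the slowest one is done.
  synchronise : ∀ {f} N {ss vs} (k : Fin (arity f) → ℕ) → (∀ i → k i ≤ N) →
    (∀ i → lookup ss i ⇉[ k i ] lookup vs i) → (∀ i → NF (lookup vs i)) →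
    ∃[ M ] (fun f ss ⇉[ M ] fun f vs × (∀ i → k i ≤ M))
  synchronise N {ss} {vs} k k≤N ps nfs with all⊎any (λ i → first (ps i))
    where
    first : ∀ {n s t} → s ⇉[ n ] t → (n ≡ 0 × s ≡ t) ⊎ (0 < n × ¬ NF s)
    first done        = inj₁ (refl , refl)
    first (step st _) = inj₂ (s≤s z≤n , λ n → nf-no-⇉ n st)
  ... | inj₁ idle with lookup-injective ss vs (proj₂ ∘ idle)
  ... | refl = 0 , done , ℕ.≤-reflexive ∘ proj₁ ∘ idle
  -- `N` serves as fuel: it bounds all remaining lengths and drops with each parallel step.
  synchronise zero    k k≤N ps nfs | inj₂ (i , 0<k , _) = contradiction (ℕ.≤-trans 0<k (k≤N i)) λ ()
  synchronise (suc N) k k≤N ps nfs | inj₂ (i , _ , ¬nf)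
    with vecChoice (λ i → par-power (nfs i) (ps i))
  ... | ts , h with synchronise N {ts} (pred ∘ k) (λ i → ℕ.pred-mono-≤ (k≤N i)) (proj₂ ∘ h) nfs
  ... | M , p , k≤M = suc M , step (⇉-args i ¬nf (proj₁ ∘ h)) p ,
    -- `k i ≤ suc (pred (k i))` also holds for idle arguments, where `k i` is 0.
    λ i → ℕ.≤-trans (ℕ.m≤n+m∸n (k i) 1) (s≤s (k≤M i))

  synchronised : ∀ {f ss vs} → (∀ i → ∃[ n ] lookup ss i ⇉[ n ] lookup vs i) →
    (∀ i → NF (lookup vs i)) →
    ∃[ M ] (fun f ss ⇉[ M ] fun f vs)
  synchronised ps nfs =
    let N , k≤N = bounded (proj₁ ∘ ps)
        M , p , _ = synchronise N (proj₁ ∘ ps) k≤N (proj₂ ∘ ps) nfs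
    in M , p

  -- Together with `→ⁱ*⇒⇓` this makes every normal form reachable by `→ⁱ` reachable by `⇉`, with no
  -- appeal to confluence.
  ⇓⇒⇉* : s ⇓ v → ∃[ n ] s ⇉[ n ] v
  ⇓⇒⇉* (nf _)      = -, done
  ⇓⇒⇉* (args es n) = synchronised (λ i → ⇓⇒⇉* (es i)) (nf-arg n)
  ⇓⇒⇉* (root es nfs ∈R eq e) =
    let _ , p = synchronised (λ i → ⇓⇒⇉* (es i)) nfs
        _ , q = ⇓⇒⇉* e
    in -, p ++ᴾ step (⇉-root ∈R eq nfs) q

  -- The double negation is there because `V` carries no decidable equality: whether a term matches
  -- a left-hand side with repeated variables cannot be decided.
  progress : ∀ u → ¬ ¬ ∃ (Par u)
  progress = term-ind _ (λ x → pure (-, inj₂ (refl , nf-var))) λ f ss ih → do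
    -- Double negation commutes with quantification over the finitely many arguments.
    h ← sequence rawApplicative ih
    let ts , par = vecChoice {Q = λ i → Par (lookup ss i)} h
    case all⊎any (λ i → Sum.map proj₂ (λ st n → nf-no-⇉ n st) (Sum.swap (par i))) of λ where
      (inj₂ (k , ¬nf)) → pure (-, inj₁ (⇉-args {ts = ts} k ¬nf par))
      (inj₁ nfs) → ¬¬-excluded-middle {A = Redex (fun f ss)} >>= λ where
        (yes (_ , _ , ∈R , _ , eq)) → pure (-, inj₁ (⇉-root ∈R eq nfs))
        (no no-redex)               → pure (-, inj₂ (refl , nf-fun no-redex nfs))

  -- While argument `i` performs its steps, the other arguments move or idle as `progress` allows,
  -- so the length is kept.
  power-arg : ∀ {n f ss} i → lookup ss i ≡ s → s ⇉[ n ] t → ¬ ¬ (∃[ u ] fun f ss ⇉[ n ] u)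
  power-arg i eq   done = pure (-, done)
  power-arg {ss = ss} i refl (step {t = s′} st p) = do
    h ← sequence rawApplicative (λ j → progress (lookup ss j))
    -- The second component forces argument `i` to take the prescribed step rather than the one
    -- offered by `progress`.
    let ts , par = vecChoice {Q = λ j t → Par (lookup ss j) t × (j ≡ i → t ≡ s′)} (move h)
    _ , q ← power-arg {ss = ts} i (proj₂ (par i) refl) p
    pure (-, step (⇉-args {ss = ss} {ts} i (λ n → nf-no-⇉ n st) (proj₁ ∘ par)) q)
    where
    move : (∀ j → ∃ (Par (lookup ss j))) → ∀ j → ∃[ t ] (Par (lookup ss j) t × (j ≡ i → t ≡ s′))
    move h j with j Fin.≟ i
    ... | yes refl = s′ , inj₁ st , λ _ → refl
    ... | no  j≢i  = proj₁ (h j) , proj₂ (h j) , λ j≡i → contradiction j≡i j≢i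

  module _ (confluent : Confluent _⇉_) where

    -- Confluence joins `t` with `v`. As `v` is a normal form, the join is `v` itself, so the
    -- derivation to `t` can be continued to `v` and only gets longer.
    power-to-nf : ∀ {n} → s ⇉[ n ] t → s ⇓ v → ∃[ m ] (n ≤ m × s ⇉[ m ] v)
    power-to-nf p e with confluent (power⇒star p) (power⇒star (proj₂ (⇓⇒⇉* e)))
    ... | _ , t⇉*w , st ◅ _ = contradiction st (nf-no-⇉ (⇓-nf e))
    ... | _ , t⇉*w , ε      = let _ , q = star⇒power t⇉*w in -, ℕ.m≤m+n _ _ , p ++ᴾ q

    mutual
      -- At a root step three derivations are concatenated: the arguments to `vs`, the root step,
      -- and the contractum. Their lengths add up to at least `a + suc b`.
      takes⇒power : ∀ {m} → Takes t m → ¬ ¬ (∃[ n ] ∃[ u ] (m ≤ n × t ⇉[ n ] u))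
      takes⇒power none               = pure (-, -, z≤n , done)
      takes⇒power (below none)       = pure (-, -, z≤n , done)
      takes⇒power (below (at i p))   = do
        _ , _ , m≤n , q ← takes⇒power p
        _ , q′ ← power-arg i refl q
        pure (-, -, m≤n , q′)
      takes⇒power (root {vs = vs} sts nfs ∈R eq as p) = do
        _ , a≤M , q ← argTakes⇒power {vs = vs} as (λ i → →ⁱ*⇒⇓ (sts i) (nfs i))
        _ , _ , b≤n , q′ ← takes⇒power p
        pure (-, -, ℕ.+-mono-≤ a≤M (s≤s b≤n) , q ++ᴾ step (⇉-root ∈R eq nfs) q′)

      -- The counted argument takes a derivation of length at least `a`, redirected by `power-to-nf`
      -- to the same result as its given evaluation. The others use any derivation to theirs, so all
      -- meet exactly at `vs`.
      argTakes⇒power : ∀ {f ss vs a} → ArgTakes ss a → (∀ i → lookup ss i ⇓ lookup vs i) →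
        ¬ ¬ (∃[ M ] (a ≤ M × fun f ss ⇉[ M ] fun f vs))
      argTakes⇒power none es =
        let M , q = synchronised (λ i → ⇓⇒⇉* (es i)) (λ i → ⇓-nf (es i)) in pure (M , z≤n , q)
      argTakes⇒power {ss = ss} {vs} {a} (at i p) es = do
        _ , _ , a≤n , q ← takes⇒power p
        let n , n≤ , q′ = power-to-nf q (es i)
            ps = slow n (ℕ.≤-trans a≤n n≤) q′
            N , k≤N = bounded (proj₁ ∘ ps)
            M , q″ , k≤M = synchronise N (proj₁ ∘ ps) k≤N (proj₁ ∘ proj₂ ∘ ps) (λ j → ⇓-nf (es j))
        pure (M , ℕ.≤-trans (proj₂ (proj₂ (ps i)) refl) (k≤M i) , q″)
        where
        slow : ∀ n → a ≤ n → lookup ss i ⇉[ n ] lookup vs i → ∀ j →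
          ∃[ k ] (lookup ss j ⇉[ k ] lookup vs j × (j ≡ i → a ≤ k))
        slow n a≤n q j with j Fin.≟ i
        ... | yes refl = n , q , λ _ → a≤n
        ... | no  j≢i  = let k , q′ = ⇓⇒⇉* (es j) in k , q′ , λ j≡i → contradiction j≡i j≢i

-- Rewriting over the signature with sharp symbols.

module Sharp {𝔽 : FiniteSignature} {V : Set} (𝓡 : TRS 𝔽 V) where
  open FiniteSignature 𝔽
  open Terms signature V
  open TRS 𝓡
  open Rewriting rules
  open TermProperties signature V
  module T = T♯ 𝓡
  module S = R♯ 𝓡

  nonVar : ∀ {ℓ r} → (ℓ ⟶ r) ∈ rules → ¬ IsVar ℓ
  nonVar ∈R = proj₁ (All.lookup wellFormed ∈R)

  nonVar♯ : ∀ {ℓ r} → (ℓ T.⟶ r) ∈ rules♯ 𝓡 → ¬ T.IsVar ℓ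
  nonVar♯ ∈R♯ _ with ∈-map⁻ _ ∈R♯
  nonVar♯ ∈R♯ (_ , refl) | (var x   ⟶ _) , ∈R , refl = nonVar ∈R (x , refl)
  nonVar♯ ∈R♯ (_ , ())   | (fun _ _ ⟶ _) , ∈R , refl

  open RewritingProperties rules nonVar
  module P = TermProperties.RewritingProperties (signature♯ 𝓡) V (rules♯ 𝓡) nonVar♯

  emb : Term → T.Term
  emb = embed 𝓡

  embs : ∀ {n} → Vec Term n → Vec T.Term n
  embs = embeds 𝓡

  mutual
    -- Substitutions of a chain tree may introduce sharp symbols anywhere. Erasing the sharps is
    -- total on such terms and left inverse to both `emb` and `♯`.
    unsharp : T.Term → Term
    unsharp (T.var x)              = var x
    unsharp (T.fun (plain f) ts)   = fun f (unsharps ts)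
    unsharp (T.fun (sharp f _) ts) = fun f (unsharps ts)

    unsharps : ∀ {n} → Vec T.Term n → Vec Term n
    unsharps []       = []
    unsharps (t ∷ ts) = unsharp t ∷ unsharps ts

  mutual
    unsharp-embed : ∀ t → unsharp (emb t) ≡ t
    unsharp-embed (var x)    = refl
    unsharp-embed (fun f ts) = cong (fun f) (unsharps-embeds ts)

    unsharps-embeds : ∀ {n} (ts : Vec Term n) → unsharps (embs ts) ≡ ts
    unsharps-embeds []       = refl
    unsharps-embeds (t ∷ ts) = cong₂ _∷_ (unsharp-embed t) (unsharps-embeds ts)

  unsharp-♯ : ∀ t → unsharp ((𝓡 ♯) t) ≡ t
  unsharp-♯ (var x) = refl
  unsharp-♯ (fun f ts) with defined? 𝓡 f
  ... | yes _ = cong (fun f) (unsharps-embeds ts)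
  ... | no  _ = cong (fun f) (unsharps-embeds ts)

  mutual
    unsharp-· : ∀ t σ → unsharp (t T.· σ) ≡ unsharp t · (unsharp ∘ σ)
    unsharp-· (T.var x) σ              = refl
    unsharp-· (T.fun (plain f) ts) σ   = cong (fun f) (unsharps-·* ts σ)
    unsharp-· (T.fun (sharp f _) ts) σ = cong (fun f) (unsharps-·* ts σ)

    unsharps-·* : ∀ {n} (ts : Vec T.Term n) σ → unsharps (ts T.·* σ) ≡ unsharps ts ·* (unsharp ∘ σ)
    unsharps-·* []       σ = refl
    unsharps-·* (t ∷ ts) σ = cong₂ _∷_ (unsharp-· t σ) (unsharps-·* ts σ)

  lookup-embeds : ∀ {n} (ts : Vec Term n) i → lookup (embs ts) i ≡ emb (lookup ts i)
  lookup-embeds (t ∷ ts) zero    = refl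
  lookup-embeds (t ∷ ts) (suc i) = lookup-embeds ts i

  embeds-[]≔ : ∀ {n} (ts : Vec Term n) i t → embs (ts [ i ]≔ t) ≡ embs ts [ i ]≔ emb t
  embeds-[]≔ (_ ∷ ts) zero    t = refl
  embeds-[]≔ (s ∷ ts) (suc i) t = cong (emb s ∷_) (embeds-[]≔ ts i t)

  mutual
    -- Agreement is asked only on the variables of `t`, since a substitution of a chain tree is
    -- known to be sharp-free only on variables of a matched left-hand side.
    embed-· : ∀ {σ τ} t → (∀ {x} → x ∈V t → σ x ≡ emb (τ x)) → emb t T.· σ ≡ emb (t · τ)
    embed-· (var x)    eq = eq here
    embed-· (fun f ts) eq = cong (T.fun (plain f)) (embeds-·* ts (λ i → eq ∘ there i))

    embeds-·* : ∀ {σ τ n} (ts : Vec Term n) → (∀ i {x} → x ∈V lookup ts i → σ x ≡ emb (τ x)) →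
      embs ts T.·* σ ≡ embs (ts ·* τ)
    embeds-·* []       eq = refl
    embeds-·* (t ∷ ts) eq = cong₂ _∷_ (embed-· t (eq zero)) (embeds-·* ts (eq ∘ suc))

  Embedded : T.Term → Set
  Embedded s = ∃[ t ] s ≡ emb t

  embedded-unsharp : ∀ {s} → Embedded s → s ≡ emb (unsharp s)
  embedded-unsharp (t , refl) = cong emb (sym (unsharp-embed t))

  embedded-arg : ∀ {f ss} → Embedded (T.fun (plain f) ss) → ∀ i → Embedded (lookup ss i)
  embedded-arg (fun f ts , refl) i = lookup ts i , lookup-embeds ts i

  mutual
    embedded-var : ∀ {σ x} t → Embedded (emb t T.· σ) → x ∈V t → Embedded (σ x)
    embedded-var (var _)    e here         = e
    embedded-var (fun f ts) e (there i x∈) = embedded-var* ts i (embedded-arg e i) x∈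

    embedded-var* : ∀ {σ x n} (ts : Vec Term n) i → Embedded (lookup (embs ts T.·* σ) i) →
      x ∈V lookup ts i → Embedded (σ x)
    embedded-var* (t ∷ ts) zero    e x∈ = embedded-var t e x∈
    embedded-var* (t ∷ ts) (suc i) e x∈ = embedded-var* ts i e x∈

  ♯-defined : ∀ {f ts} (d : Defined 𝓡 f) → (𝓡 ♯) (fun f ts) ≡ T.fun (sharp f d) (embs ts)
  ♯-defined {f} d with defined? 𝓡 f
  ... | yes _ = refl
  ... | no ¬d = contradiction d ¬d

  unsharp-match : ∀ {t σ} ℓ → emb t ≡ emb ℓ T.· σ → t ≡ ℓ · (unsharp ∘ σ)
  unsharp-match {t} {σ} ℓ eq = trans (sym (unsharp-embed t)) (trans (cong unsharp eq)
    (trans (unsharp-· (emb ℓ) σ) (cong (_· (unsharp ∘ σ)) (unsharp-embed ℓ))))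

  rewrite-embed : ∀ {Q Q♯ t t′} → (∀ u → Q u → Q♯ (emb u)) → Rewrite Q t t′ →
    P.Rewrite Q♯ (emb t) (emb t′)
  rewrite-embed Q⇒ (root {ℓ = ℓ} {r} ∈R eq q) =
    subst (P.Rewrite _ _) (embed-· r (λ _ → refl))
      (P.root (∈-map⁺ _ ∈R) (trans (cong emb eq) (sym (embed-· ℓ (λ _ → refl)))) (Q⇒ _ q))
  rewrite-embed Q⇒ (arg {f} {ss} {t} i st) =
    subst (P.Rewrite _ _) (cong (T.fun (plain f)) (sym (embeds-[]≔ ss i t)))
      (P.arg i (subst (λ s → P.Rewrite _ s _) (sym (lookup-embeds ss i)) (rewrite-embed Q⇒ st)))

  -- No sharp symbol can enter: variables of `r` occur in `ℓ`, and the matched instance of `ℓ` is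
  -- embedded.
  rewrite-unembed : ∀ {Q Q♯ s s′} → (∀ u → Q♯ (emb u) → Q u) → P.Rewrite Q♯ s s′ →
    ∀ t → s ≡ emb t →
    ∃[ t′ ] (s′ ≡ emb t′ × Rewrite Q t t′)
  rewrite-unembed Q⇐ (P.root ∈R♯ eq q) (fun f ts) refl with ∈-map⁻ _ ∈R♯
  ... | (ℓ ⟶ r) , ∈R , refl = _ , embed-· r agree , root ∈R (unsharp-match ℓ eq) (Q⇐ _ q)
    where
    agree : ∀ {x} → x ∈V r → _
    agree x∈r = embedded-unsharp
      (embedded-var ℓ (_ , sym eq) (proj₂ (All.lookup wellFormed ∈R) _ x∈r))
  rewrite-unembed Q⇐ (P.arg i st) (fun f ts) refl
    with rewrite-unembed Q⇐ st (lookup ts i) (lookup-embeds ts i)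
  ... | t′ , refl , st′ = _ , cong (T.fun (plain f)) (sym (embeds-[]≔ ts i t′)) , arg i st′

  nf-embed : ∀ {t} → NF t → S.NF (emb t)
  nf-embed nf (_ , st) with rewrite-unembed (λ _ → id) (P.step⇒rewrite st) _ refl
  ... | _ , _ , st′ = nf (-, rewrite⇒step st′)

  nf-unembed : ∀ {t} → S.NF (emb t) → NF t
  nf-unembed nf (_ , st) = nf (-, P.rewrite⇒step (rewrite-embed (λ _ → id) (step⇒rewrite st)))

  argsNF-embed : ∀ t → ArgsNF t → P.ArgsNF (emb t)
  argsNF-embed (var _)    _   = tt
  argsNF-embed (fun f ts) nfs i = subst S.NF (sym (lookup-embeds ts i)) (nf-embed (nfs i))

  argsNF-unembed : ∀ t → P.ArgsNF (emb t) → ArgsNF t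
  argsNF-unembed (var _)    _   = tt
  argsNF-unembed (fun f ts) nfs i = nf-unembed (subst S.NF (lookup-embeds ts i) (nfs i))

  -- Left-hand sides have plain roots. Hence a sharp root is never contracted and rewriting stays in
  -- the arguments.
  sharp-no-redex : ∀ {f ss ℓ r σ} .{d : Defined 𝓡 f} → (ℓ T.⟶ r) ∈ rules♯ 𝓡 →
    T.fun (sharp f d) ss ≢ ℓ T.· σ
  sharp-no-redex ∈R♯ eq with ∈-map⁻ _ ∈R♯
  sharp-no-redex ∈R♯ eq | (var x   ⟶ _) , ∈R , refl = nonVar ∈R (x , refl)
  sharp-no-redex ∈R♯ () | (fun _ _ ⟶ _) , ∈R , refl

  nf-sharp : ∀ {f ts} .{d : Defined 𝓡 f} → (∀ i → NF (lookup ts i)) →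
    S.NF (T.fun (sharp f d) (embs ts))
  nf-sharp {ts = ts} nfs (_ , st) with P.step⇒rewrite st
  ... | P.arg i st′ = nf-embed (nfs i)
    (-, P.rewrite⇒step (subst (λ s → P.Rewrite _ s _) (lookup-embeds ts i) st′))
  ... | P.root ∈R♯ eq _ = sharp-no-redex ∈R♯ eq

  nf-unsharp : ∀ {f ts} .{d : Defined 𝓡 f} → S.NF (T.fun (sharp f d) (embs ts)) →
    ∀ i → NF (lookup ts i)
  nf-unsharp {ts = ts} nf i = nf-unembed (subst S.NF (lookup-embeds ts i) (P.nf-arg nf i))

  →ⁱ-embed : ∀ {s t} → s →ⁱ t → emb s S.→ⁱ emb t
  →ⁱ-embed st = P.rewrite⇒→ⁱ (rewrite-embed argsNF-embed (→ⁱ⇒rewrite st))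

  →ⁱ*-sharp : ∀ {f ts us} .{d : Defined 𝓡 f} → (∀ i → Star _→ⁱ_ (lookup ts i) (lookup us i)) →
    Star S._→ⁱ_ (T.fun (sharp f d) (embs ts)) (T.fun (sharp f d) (embs us))
  →ⁱ*-sharp {ts = ts} {us} sts = P.→ⁱ*-args λ i →
    subst₂ (Star S._→ⁱ_) (sym (lookup-embeds ts i)) (sym (lookup-embeds us i))
      (gmap emb →ⁱ-embed (sts i))

  -- Each step lies inside an argument, and the arguments stay embedded. The start is given by an
  -- equation so that induction on the sequence can replace it.
  →ⁱ*-unsharp : ∀ {f s₀ s} ts .{d : Defined 𝓡 f} → s₀ ≡ T.fun (sharp f d) (embs ts) →
    Star S._→ⁱ_ s₀ s →
    ∃[ us ] (s ≡ T.fun (sharp f d) (embs us) × (∀ i → Star _→ⁱ_ (lookup ts i) (lookup us i)))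
  →ⁱ*-unsharp ts refl ε = ts , refl , λ _ → ε
  →ⁱ*-unsharp ts refl (st ◅ sts) with P.→ⁱ⇒rewrite st
  ... | P.root ∈R♯ eq _ = contradiction eq (sharp-no-redex ∈R♯)
  ... | P.arg {t = t} i st′ with rewrite-unembed argsNF-unembed st′ (lookup ts i) (lookup-embeds ts i)
  ...   | t′ , refl , st″
    with →ⁱ*-unsharp (ts [ i ]≔ t′) (cong (T.fun _) (sym (embeds-[]≔ ts i t′))) sts
  ...   | us , eq , sts′ = us , eq , all
    where
    all : ∀ j → Star _→ⁱ_ (lookup ts j) (lookup us j)
    all j with j Fin.≟ i | sts′ j
    ... | yes refl | st‴ rewrite lookup∘update i ts t′     = rewrite⇒→ⁱ st″ ◅ st‴
    ... | no  j≢i  | st‴ rewrite lookup∘update′ j≢i ts t′  = st‴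

-- Finite chain trees yield `Takes`.

module DependencyTuples {𝔽 : FiniteSignature} {V : Set} (𝓡 : TRS 𝔽 V) where
  open FiniteSignature 𝔽
  open Terms signature V
  open TRS 𝓡
  open Rewriting rules
  open TermProperties signature V
  open Sharp 𝓡
  open RewritingProperties rules nonVar
  open ParallelTime signature V rules nonVar
  open DT

  infix 9 _♯ᴿ

  _♯ᴿ : Term → T.Term
  t ♯ᴿ = (𝓡 ♯) t

  rule-defined : ∀ {f ls r} → (fun f ls ⟶ r) ∈ rules → Defined 𝓡 f
  rule-defined ∈R = Any.map (λ { refl → -, refl }) ∈R

  root-defined : ∀ {f ss ℓ r σ} → (ℓ ⟶ r) ∈ rules → fun f ss ≡ ℓ · σ → Defined 𝓡 f
  root-defined {ℓ = var x}   ∈R _    = contradiction (x , refl) (nonVar ∈R)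
  root-defined {ℓ = fun _ _} ∈R refl = rule-defined ∈R

  -- Finite chain trees, indexed by their number of nodes.  Children are listed along the
  -- targets of the node, and skip marks a target without a child.
  mutual
    data ChainTree (s : T.Term) : ℕ → Set where
      node : ∀ {m} d μ → s ≡ source d T.· μ → PDT 𝓡 d → S.NF (source d T.· μ) →
             Children μ (targets d) m → ChainTree s (suc m)

    data Children (μ : T.Subst) : List T.Term → ℕ → Set where
      []    : Children μ [] 0
      skip  : ∀ {t ts m} → Children μ ts m → Children μ (t ∷ ts) m
      child : ∀ {t s ts k m} → Star S._→ⁱ_ (t T.· μ) s → ChainTree s k →
              Children μ ts m → Children μ (t ∷ ts) (k + m)

  skips : ∀ {μ} ts → Children μ ts 0
  skips []       = []
  skips (_ ∷ ts) = skip (skips ts)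

  _++ᶜ_ : ∀ {μ ts us m n} → Children μ ts m → Children μ us n → Children μ (ts ++ us) (m + n)
  []            ++ᶜ ds = ds
  skip cs       ++ᶜ ds = skip (cs ++ᶜ ds)
  child {k = k} sts c cs ++ᶜ ds =
    subst (Children _ _) (sym (ℕ.+-assoc k _ _)) (child sts c (cs ++ᶜ ds))

  TargetTerms : ∀ r → List (Pos r) → List T.Term
  TargetTerms r = List.map (λ π → (r ∣ π) ♯ᴿ)

  argTakes-subst : ∀ {g us σ m} t → t ≡ fun g us → (π : Pos t) → π ≢ ε →
    Takes ((t ∣ π) · σ) m → ArgTakes (us ·* σ) m
  argTakes-subst _ refl ε π≢ε p = contradiction refl π≢ε
  argTakes-subst {us = us} {σ} _ refl (i ◂ π) _ p =
    at i (subst (λ t → Takes t _) (sym (lookup-·* us σ i)) (takes-subst (lookup us i) π p))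

  mutual
    -- The result is left as a rule, a match and a count for the contractum, not packed into
    -- `Takes (fun f ts) m`: the parent node still has to insert the evaluation leading to `ts` and
    -- the count from its deeper positions.
    chainTree⇒takes : ∀ {s m f ts} .{d : Defined 𝓡 f} → ChainTree s m →
      s ≡ T.fun (sharp f d) (embs ts) →
      (∀ i → NF (lookup ts i)) × (∃[ ℓ ] ∃[ r ] ∃[ σ ] ∃[ b ] (m ≡ suc b × (ℓ ⟶ r) ∈ rules ×
        fun f ts ≡ ℓ · σ × Takes (r · σ) b))
    chainTree⇒takes (node d μ eq ((var x ⟶ r) , ∈R , _) _ _) _ =
      contradiction (x , refl) (nonVar ∈R)
    chainTree⇒takes {f = f} {ts} {d = df} 
      (node {m} d μ refl ((fun g ls ⟶ r) , ∈R , πs , ((defs , linked) , _) , src , tgt) nf kids) eq =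
      nf-unsharp (subst S.NF eq nf) ,
      fun g ls , r , unsharp ∘ μ , m , refl , ∈R , matches ,
      children⇒takes r agree πs defs linked tgt kids
      where
      eq′ : fun g ls ♯ᴿ T.· μ ≡ T.fun (sharp f df) (embs ts)
      eq′ = trans (cong (T._· μ) (sym src)) eq

      matches : fun f ts ≡ fun g ls · (unsharp ∘ μ)
      matches = trans (sym (cong (fun f) (unsharps-embeds ts)))
        (trans (sym (cong unsharp eq′))
        (trans (unsharp-· (fun g ls ♯ᴿ) μ) (cong (_· (unsharp ∘ μ)) (unsharp-♯ (fun g ls)))))

      args-embedded : ∀ {f g ss us} .{d : Defined 𝓡 f} .{e : Defined 𝓡 g} →
        T.fun (sharp g e) us ≡ T.fun (sharp f d) (embs ss) → ∀ i → Embedded (lookup us i)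
      args-embedded {ss = ss} refl i = -, lookup-embeds ss i

      -- Each variable of `r` occurs in an argument of the left-hand side, and the arguments of the
      -- instantiated source are embedded.
      agree : ∀ {x} → x ∈V r → μ x ≡ emb (unsharp (μ x))
      agree x∈r with proj₂ (All.lookup wellFormed ∈R) _ x∈r
      ... | there i x∈ = embedded-unsharp (embedded-var* ls i
        (args-embedded (trans (cong (T._· μ) (sym (♯-defined (rule-defined ∈R)))) eq′) i) x∈)

    children⇒takes : ∀ r {σ μ b ts} → (∀ {x} → x ∈V r → μ x ≡ emb (σ x)) → ∀ πs →
      All (Posᵈ 𝓡 r) πs → Linked _>ᵖ_ πs → ts ≡ TargetTerms r πs →
      Children μ ts b → Takes (r · σ) b
    children⇒takes r agree [] _ _ refl [] = none
    children⇒takes r agree (π ∷ πs) ((_ , df , _ , eq) ∷ defs) linked tgt kids =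
      chain⇒takes r agree π πs eq df none defs linked tgt kids

    -- The chain is walked from its deepest position outwards. The accumulator `a` is the count
    -- found so far, strictly below `π`; a child at `π` contributes a root step on top of it.
    chain⇒takes : ∀ r {σ μ a b ts} → (∀ {x} → x ∈V r → μ x ≡ emb (σ x)) → ∀ π πs {g us} →
      r ∣ π ≡ fun g us → Defined 𝓡 g → ArgTakes (us ·* σ) a →
      All (Posᵈ 𝓡 r) πs → Linked _>ᵖ_ (π ∷ πs) → ts ≡ TargetTerms r (π ∷ πs) →
      Children μ ts b → Takes (r · σ) (a + b)
    chain⇒takes r {σ} agree π πs eq df as defs linked refl (skip kids) =
      next⇒takes r agree π πs
        (subst (λ t → Takes (t · σ) _) (sym eq) (below as))
        defs linked refl kids
    chain⇒takes r {σ} {μ} {a} agree π πs {g} {us} eq df as defs linked refl (child {k = k} sts c kids)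
      with →ⁱ*-unsharp (us ·* σ) {d = df} start sts
      where
      start : (r ∣ π) ♯ᴿ T.· μ ≡ T.fun (sharp g df) (embs (us ·* σ))
      start = trans (cong (λ t → t ♯ᴿ T.· μ) eq) (trans (cong (T._· μ) (♯-defined df))
        (cong (T.fun (sharp g df)) (embeds-·* us λ i x∈ →
          agree (∈V-∣ r π (subst (_ ∈V_) (sym eq) (there i x∈))))))
    ... | vs , eq′ , sts′ with chainTree⇒takes c eq′
    ...   | nfs , _ , _ , _ , b , refl , ∈R , eq″ , p =
      subst (Takes _) (ℕ.+-assoc a k _) (next⇒takes r agree π πs
        (subst (λ t → Takes (t · σ) _) (sym eq) (root sts′ nfs ∈R eq″ as p))
        defs linked refl kids)

    -- Since `π` lies strictly below the next position `π₂`, the count at `π` is a count in an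
    -- argument of the subterm at `π₂`.
    next⇒takes : ∀ r {σ μ c b ts} → (∀ {x} → x ∈V r → μ x ≡ emb (σ x)) → ∀ π πs →
      Takes ((r ∣ π) · σ) c →
      All (Posᵈ 𝓡 r) πs → Linked _>ᵖ_ (π ∷ πs) → ts ≡ TargetTerms r πs →
      Children μ ts b → Takes (r · σ) (c + b)
    next⇒takes r agree π [] p _ _ refl [] =
      subst (Takes _) (sym (ℕ.+-identityʳ _)) (takes-subst r π p)
    next⇒takes r {σ} agree π (π₂ ∷ πs) p ((_ , df , _ , eq) ∷ defs) ((π′ , π′≢ε , π≡) ∷ linked) tgt kids =
      chain⇒takes r agree π₂ πs eq df
        (argTakes-subst (r ∣ π₂) eq π′ π′≢ε
          (subst (λ t → Takes (t · σ) _) (trans (cong (r ∣_) π≡) (∣-∙ r π₂ π′)) p))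
        defs linked tgt kids

-- `Takes` yields finite chain trees.

module MaximalChains {𝔽 : FiniteSignature} {V : Set} (𝓡 : TRS 𝔽 V) where
  open FiniteSignature 𝔽
  open Terms signature V
  open TRS 𝓡
  open Rewriting rules
  open TermProperties signature V
  open Sharp 𝓡
  open RewritingProperties rules nonVar
  open ParallelTime signature V rules nonVar
  open DependencyTuples 𝓡
  open DT

  -- The root's share of a maximal chain. It is kept as a suffix because chains run from deep
  -- positions outwards.
  rootChain : ∀ f ts → List (Pos (fun f ts))
  rootChain f ts with defined? 𝓡 f
  ... | yes _ = ε ∷ []
  ... | no  _ = []

  msdc-root : ∀ f ts → (∀ i → MSDC 𝓡 (lookup ts i) []) → MSDC 𝓡 (fun f ts) (rootChain f ts)
  msdc-root f ts leaf with defined? 𝓡 f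
  ... | yes d = ((f , d , ts , refl) ∷ [] , [-]) , λ where
    ε       _ → (λ { (ε , ρ≢ε , _) → ρ≢ε refl }) , λ { (ε , ρ≢ε , _) → contradiction refl ρ≢ε }
    (i ◂ π) p → contradiction p (proj₂ (leaf i) π)
  ... | no ¬d = ([] , []) , λ where
    ε       (_ , d , _ , refl) → ¬d d
    (i ◂ π) p                  → proj₂ (leaf i) π p

  >ᵖ-arg : ∀ {f ts i} {τ π : Pos (lookup ts i)} → τ >ᵖ π → _>ᵖ_ {fun f ts} (i ◂ τ) (i ◂ π)
  >ᵖ-arg (ρ , ρ≢ε , refl) = ρ , ρ≢ε , refl

  linked-root : ∀ {f ts} i (πs : List (Pos (lookup ts i))) → Linked _>ᵖ_ πs →
    Linked _>ᵖ_ (List.map (i ◂_) πs ++ ε {t = fun f ts} ∷ [])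
  linked-root i []           []        = [-]
  linked-root i (π ∷ [])     [-]       = (i ◂ π , (λ ()) , refl) ∷ [-]
  linked-root i (π ∷ _ ∷ πs) (gt ∷ ls) = >ᵖ-arg gt ∷ linked-root i _ ls

  -- Maximality of a nonempty chain concerns only positions comparable with its deepest one. These
  -- lie in argument `i` or at the root, so defined positions in other arguments do no harm.
  msdc-arg : ∀ f ts i {π πs} → MSDC 𝓡 (lookup ts i) (π ∷ πs) →
    MSDC 𝓡 (fun f ts) (List.map (i ◂_) (π ∷ πs) ++ rootChain f ts)
  msdc-arg f ts i {π} {πs} ((defs , linked) , maximal) =
    (All.++⁺ (All.map⁺ defs) (proj₁ chain) , proj₁ (proj₂ chain)) ,
    λ τ τᵈ → deepest τ τᵈ , complete τ τᵈ
    where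
    chain : All (Posᵈ 𝓡 (fun f ts)) (rootChain f ts) ×
      Linked _>ᵖ_ (List.map (i ◂_) (π ∷ πs) ++ rootChain f ts) ×
      (Defined 𝓡 f → ε ∈ rootChain f ts)
    chain with defined? 𝓡 f
    ... | yes d = (f , d , ts , refl) ∷ [] , linked-root i _ linked , λ _ → here refl
    ... | no ¬d = [] ,
      subst (Linked _>ᵖ_) (sym (++-identityʳ _)) (Linked.map⁺ (Linked.map >ᵖ-arg linked)) ,
      λ d → contradiction d ¬d

    deepest : ∀ τ → Posᵈ 𝓡 (fun f ts) τ → ¬ (τ >ᵖ i ◂ π)
    deepest τ τᵈ (ρ , ρ≢ε , refl) = proj₁ (maximal (π ∙ ρ) τᵈ) (ρ , ρ≢ε , refl)

    complete : ∀ τ → Posᵈ 𝓡 (fun f ts) τ → i ◂ π >ᵖ τ → τ ∈ List.map (i ◂_) πs ++ rootChain f ts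
    complete ε (_ , d , _ , refl) _ = ∈-++⁺ʳ (List.map (i ◂_) πs) (proj₂ (proj₂ chain) d)
    complete (j ◂ τ) τᵈ (ρ , ρ≢ε , refl) =
      ∈-++⁺ˡ (∈-map⁺ (i ◂_) (proj₂ (maximal τ τᵈ) (ρ , ρ≢ε , refl)))

  -- An argument with a nonempty chain is preferred; the root's share alone is maximal only if no
  -- argument has a defined position.
  msdc-fun : ∀ f ts → (∀ i → ∃ (MSDC 𝓡 (lookup ts i))) →
    ∃[ πs ] MSDC 𝓡 (fun f ts) (πs ++ rootChain f ts)
  msdc-fun f ts chains with all⊎any (λ i → empty? (chains i))
    where
    empty? : ∀ {t} → ∃ (MSDC 𝓡 t) → MSDC 𝓡 t [] ⊎ (∃[ π ] ∃[ πs ] MSDC 𝓡 t (π ∷ πs))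
    empty? ([]     , c) = inj₁ c
    empty? (π ∷ πs , c) = inj₂ (π , πs , c)
  ... | inj₁ leaf             = [] , msdc-root f ts leaf
  ... | inj₂ (i , π , πs , c) = List.map (i ◂_) (π ∷ πs) , msdc-arg f ts i c

  msdc-var : ∀ x → MSDC 𝓡 (var x) []
  msdc-var x = ([] , []) , λ { ε (_ , _ , _ , ()) }

  msdc-exists : ∀ t → ∃ (MSDC 𝓡 t)
  msdc-exists = term-ind _ (λ x → [] , msdc-var x) λ f ts chains →
    let πs , c = msdc-fun f ts chains in πs ++ rootChain f ts , c

  argTargets : ∀ {f ts i μ m} (πs : List (Pos (lookup ts i))) →
    Children μ (TargetTerms (lookup ts i) πs) m →
    Children μ (TargetTerms (fun f ts) (List.map (i ◂_) πs)) m
  argTargets {μ = μ} {m} πs = subst (λ ts → Children μ ts m) (map-∘ πs)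

  appendTargets : ∀ {r μ m} (πs : List (Pos r)) {ρs} →
    Children μ (TargetTerms r πs ++ TargetTerms r ρs) m → Children μ (TargetTerms r (πs ++ ρs)) m
  appendTargets {μ = μ} {m} πs {ρs} = subst (λ ts → Children μ ts m) (sym (map-++ _ πs ρs))

  ChainChildren : ∀ r → Subst → List (Pos r) → ℕ → Set
  ChainChildren r σ πs b = ∃[ m ] (b ≤ m × Children (emb ∘ σ) (TargetTerms r πs) m)

  chainTree-root : ∀ {f vs r ℓ σ b πs} .{d : Defined 𝓡 f} → (∀ i → NF (lookup vs i)) →
    (ℓ ⟶ r) ∈ rules → fun f vs ≡ ℓ · σ → MSDC 𝓡 r πs → ChainChildren r σ πs b →
    ∃[ k ] (suc b ≤ k × ChainTree (T.fun (sharp f d) (embs vs)) k)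
  chainTree-root {ℓ = var x} _ ∈R _ _ _ = contradiction (x , refl) (nonVar ∈R)
  chainTree-root {f} {r = r} {fun f ls} {σ} {πs = πs} {df} nfs ∈R refl msdc (m , b≤m , kids) =
    suc m , s≤s b≤m ,
    node dt (emb ∘ σ) (sym instantiated) (-, ∈R , πs , msdc , refl , refl)
      (subst S.NF (sym instantiated) (nf-sharp nfs)) kids
    where
    dt : DT 𝓡
    dt = record
      { source   = fun f ls ♯ᴿ
      ; targets  = TargetTerms r πs
      ; source♯  = fun f ls , (f , rule-defined ∈R , ls , refl) , refl
      ; targets♯ = All.map⁺ (All.map (λ {π} d → r ∣ π , d , refl) (proj₁ (proj₁ msdc)))
      }

    instantiated : fun f ls ♯ᴿ T.· (emb ∘ σ) ≡ T.fun (sharp f df) (embs (ls ·* σ))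
    instantiated = trans (cong (T._· (emb ∘ σ)) (♯-defined (rule-defined ∈R)))
      (cong (T.fun _) (embeds-·* ls (λ _ _ → refl)))

  -- Variables of `r` occur in arguments of `ℓ`, whose instances are normal. So nothing is counted
  -- inside the substituted part of a contractum.
  rhs-nf : ∀ {ℓ r f vs σ} → (ℓ ⟶ r) ∈ rules → fun f vs ≡ ℓ · σ → (∀ i → NF (lookup vs i)) →
    ∀ {x} → x ∈V r → NF (σ x)
  rhs-nf {var x} ∈R _ _ _ = contradiction (x , refl) (nonVar ∈R)
  rhs-nf {fun f ls} {σ = σ} ∈R refl nfs x∈r with proj₂ (All.lookup wellFormed ∈R) _ x∈r
  ... | there i x∈ = nf-subst (lookup ls i) (subst NF (lookup-·* ls σ i) (nfs i)) x∈

  mutual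
    -- The count follows one path down `r`, and its root steps on this path sit at nested positions.
    -- Where the count stops, any maximal chain completes the path and its targets are skipped.
    takes⇒children : ∀ {u b σ} → Takes u b → ∀ r → u ≡ r · σ → (∀ {x} → x ∈V r → NF (σ x)) →
      ∃[ πs ] (MSDC 𝓡 r πs × ChainChildren r σ πs b)
    takes⇒children p (var x) refl nfs with nf-takes (nfs here) p
    ... | refl = [] , msdc-var x , 0 , z≤n , []
    takes⇒children none (fun f rs) refl nfs =
      let πs , c = msdc-exists (fun f rs) in πs , c , 0 , z≤n , skips _
    takes⇒children {σ = σ} (below as) (fun f rs) refl nfs
      with argTakes⇒children f rs as refl (λ i → nfs ∘ there i)
    ... | πs , c , m , a≤m , kids = πs ++ rootChain f rs , c , m + 0 ,
      ℕ.≤-trans a≤m (ℕ.m≤m+n m 0) ,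
      appendTargets πs (kids ++ᶜ skips _)
    takes⇒children {σ = σ} (root {a = a} {b} {r = r′} {σ = τ} sts nfs ∈R eq as p) (fun f rs) refl nfs′
      with argTakes⇒children f rs as refl (λ i → nfs′ ∘ there i) 
         | takes⇒children p r′ refl (rhs-nf ∈R eq nfs)
    ... | πs , c , m , a≤m , kids | ρs , c′ , kids′ =
      let k , b<k , kid = rootChild in
      πs ++ rootChain f rs , c , m + k , ℕ.+-mono-≤ a≤m b<k ,
      appendTargets πs (kids ++ᶜ kid)
      where
      rootChild : ∃[ k ] (suc b ≤ k × Children (emb ∘ σ) (TargetTerms (fun f rs) (rootChain f rs)) k)
      rootChild with defined? 𝓡 f
      ... | no ¬d = contradiction (root-defined ∈R eq) ¬d
      ... | yes d with chainTree-root {d = d} nfs ∈R eq c′ kids′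
      ...   | k , b<k , tree = k + 0 , ℕ.≤-trans b<k (ℕ.m≤m+n k 0) ,
        child (subst (λ s → Star S._→ⁱ_ s _) (sym start) (→ⁱ*-sharp sts)) tree []
        where
        start : fun f rs ♯ᴿ T.· (emb ∘ σ) ≡ T.fun (sharp f d) (embs (rs ·* σ))
        start = trans (cong (T._· (emb ∘ σ)) (♯-defined d))
          (cong (T.fun _) (embeds-·* rs (λ _ _ → refl)))

    argTakes⇒children : ∀ f rs {us : Vec Term (arity f)} {a σ} → ArgTakes us a → us ≡ rs ·* σ →
      (∀ i {x} → x ∈V lookup rs i → NF (σ x)) →
      ∃[ πs ] (MSDC 𝓡 (fun f rs) (πs ++ rootChain f rs) × ChainChildren (fun f rs) σ πs a)
    argTakes⇒children f rs none _ _ =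
      let πs , c = msdc-fun f rs (λ i → msdc-exists (lookup rs i)) in πs , c , 0 , z≤n , skips _
    argTakes⇒children f rs {σ = σ} (at i p) refl nfs
      with takes⇒children p (lookup rs i) (lookup-·* rs σ i) (nfs i)
    -- Argument `i` has no defined position, so `a` is 0. Another argument may have one, hence the
    -- chain is chosen afresh.
    ... | [] , _ , _ , z≤n , [] =
      let πs , c = msdc-fun f rs (λ i → msdc-exists (lookup rs i)) in πs , c , 0 , z≤n , skips _
    ... | π ∷ πs , c , m , a≤m , kids = List.map (i ◂_) (π ∷ πs) , msdc-arg f rs i c , m , a≤m ,
      argTargets (π ∷ πs) kids

  -- With normal arguments a positive count must come from a root step, and its rule labels the root
  -- node.
  takes⇒chainTree : ∀ {f ss m} → Defined 𝓡 f → (∀ i → NF (lookup ss i)) →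
    Takes (fun f ss) m → 0 < m →
    ∃[ k ] (m ≤ k × ChainTree (fun f ss ♯ᴿ) k)
  takes⇒chainTree d nfs (below as) 0<m = contradiction (nfs-take nfs as) (ℕ.>⇒≢ 0<m)
  takes⇒chainTree {ss = ss} d nfs (root {vs = vs} {r = r} sts nfs′ ∈R eq as p) _
    with lookup-injective ss vs (λ i → nf-star (nfs i) (sts i)) | nfs-take nfs as
  ... | refl | refl =
    let πs , c , kids = takes⇒children p r refl (rhs-nf ∈R eq nfs)
        k , b<k , tree = chainTree-root {d = d} nfs ∈R eq c kids
    in k , b<k , subst (λ s → ChainTree s k) (sym (♯-defined d)) tree

-- Finite chain trees as labelled trees.

module FiniteToTree {𝔽 : FiniteSignature} {V : Set} (𝓡 : TRS 𝔽 V) where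
  open Sharp 𝓡
  open DependencyTuples 𝓡
  open DT

  mutual
    -- The child at the `j`-th target gets child index `j`, with gaps at skipped targets. This makes
    -- the assignment of targets to children injective.
    labelAt : ∀ {s m} → ChainTree s m → List ℕ → Maybe (Label 𝓡)
    labelAt (node d μ _ _ _ _)    []      = just (d , μ)
    labelAt (node _ _ _ _ _ kids) (j ∷ w) = labelBelow kids j w

    labelBelow : ∀ {μ ts m} → Children μ ts m → ℕ → List ℕ → Maybe (Label 𝓡)
    labelBelow []             _       _ = nothing
    labelBelow (skip kids)    zero    _ = nothing
    labelBelow (skip kids)    (suc j) w = labelBelow kids j w
    labelBelow (child _ c _)  zero    w = labelAt c w
    labelBelow (child _ _ kids) (suc j) w = labelBelow kids j w

  mutual
    labelAt-closed : ∀ {s m} (c : ChainTree s m) w j {a} →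
      labelAt c (w ∷ʳ j) ≡ just a → ∃[ b ] labelAt c w ≡ just b
    labelAt-closed (node _ _ _ _ _ _)    []      j eq = -, refl
    labelAt-closed (node _ _ _ _ _ kids) (i ∷ w) j eq = labelBelow-closed kids i w j eq

    labelBelow-closed : ∀ {μ ts m} (kids : Children μ ts m) i w j {a} →
      labelBelow kids i (w ∷ʳ j) ≡ just a → ∃[ b ] labelBelow kids i w ≡ just b
    labelBelow-closed (skip kids)      (suc i) w j eq = labelBelow-closed kids i w j eq
    labelBelow-closed (child _ c _)    zero    w j eq = labelAt-closed c w j eq
    labelBelow-closed (child _ _ kids) (suc i) w j eq = labelBelow-closed kids i w j eq

  -- The labelling is taken relative to the node, so that the descent along a path can pass the same
  -- statement on unchanged.
  Node : (List ℕ → Maybe (Label 𝓡)) → DT 𝓡 → T.Subst → Set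
  Node at d μ = PDT 𝓡 d × S.NF (source d T.· μ) × (∃[ m ] Σ (Children μ (targets d) m) λ kids →
    ∀ j → at (j ∷ []) ≡ labelBelow kids j [])

  mutual
    nodeAt : ∀ {s m} (c : ChainTree s m) w {d μ} → labelAt c w ≡ just (d , μ) →
      Node (λ u → labelAt c (w ++ u)) d μ
    nodeAt (node d μ _ pdt nf kids) []      refl = pdt , nf , -, kids , λ _ → refl
    nodeAt (node _ _ _ _ _ kids)    (j ∷ w) eq   = nodeBelow kids j w eq

    nodeBelow : ∀ {ν ts m} (kids : Children ν ts m) j w {d μ} → labelBelow kids j w ≡ just (d , μ) →
      Node (λ u → labelBelow kids j (w ++ u)) d μ
    nodeBelow (skip kids)      (suc j) w eq = nodeBelow kids j w eq
    nodeBelow (child _ c _)    zero    w eq = nodeAt c w eq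
    nodeBelow (child _ _ kids) (suc j) w eq = nodeBelow kids j w eq

  childTarget : ∀ {μ ts m} (kids : Children μ ts m) j {p δ} → labelBelow kids j [] ≡ just (p , δ) →
    ∃[ i ] (toℕ i ≡ j × Star S._→ⁱ_ (List.lookup ts i T.· μ) (source p T.· δ))
  childTarget (skip kids) (suc j) eq with childTarget kids j eq
  ... | i , eq′ , sts = suc i , cong suc eq′ , sts
  childTarget (child sts (node _ _ refl _ _ _) _) zero refl = zero , refl , sts
  childTarget (child _ _ kids) (suc j) eq with childTarget kids j eq
  ... | i , eq′ , sts = suc i , cong suc eq′ , sts

  tree : ∀ {s m} → ChainTree s m → Tree 𝓡
  tree c = record { at = labelAt c ; root = labelAt-root c ; closed = labelAt-closed c }
    where
    labelAt-root : ∀ {s m} (c : ChainTree s m) → ∃[ a ] labelAt c [] ≡ just a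
    labelAt-root (node _ _ _ _ _ _) = -, refl

  isChainTree : ∀ {s m} (c : ChainTree s m) → IsChainTree 𝓡 (PDT 𝓡) (tree c) s
  isChainTree c@(node d μ eq _ _ _) = record
    { startsAt = d , μ , refl , eq
    ; labels   = λ w e → proj₁ (nodeAt c w e)
    ; normal   = λ w e → proj₁ (proj₂ (nodeAt c w e))
    ; children = λ w e →
        let _ , _ , _ , kids , at≡ = nodeAt c w e
            target : ∀ j {p δ} → labelAt c (w ∷ʳ j) ≡ just (p , δ) → _
            target j e′ = childTarget kids j (trans (sym (at≡ j)) e′)
        in (λ j e′ → proj₁ (target j e′))
         , (λ j j′ e₁ e₂ ι≡ → trans (sym (proj₁ (proj₂ (target j e₁))))
             (trans (cong toℕ ι≡) (proj₁ (proj₂ (target j′ e₂)))))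
         , λ j e′ → proj₂ (proj₂ (target j e′))
    }

  private
    Path = ℕ × List ℕ

    first : List ℕ → Path
    first w = 0 , w

    next : Path → Path
    next (j , w) = suc j , w

    next-injective : ∀ {v w} → next v ≡ next w → v ≡ w
    next-injective refl = refl

    cons : Path → List ℕ
    cons (j , w) = j ∷ w

    cons-injective : ∀ {v w} → cons v ≡ cons w → v ≡ w
    cons-injective refl = refl

  mutual
    nodes : ∀ {s m} → ChainTree s m → List (List ℕ)
    nodes (node _ _ _ _ _ kids) = [] ∷ List.map cons (nodesBelow kids)

    nodesBelow : ∀ {μ ts m} → Children μ ts m → List Path
    nodesBelow []               = []
    nodesBelow (skip kids)      = List.map next (nodesBelow kids)
    nodesBelow (child _ c kids) = List.map first (nodes c) ++ List.map next (nodesBelow kids)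

  mutual
    length-nodes : ∀ {s m} (c : ChainTree s m) → length (nodes c) ≡ m
    length-nodes (node _ _ _ _ _ kids) =
      cong suc (trans (length-map cons (nodesBelow kids)) (length-nodesBelow kids))

    length-nodesBelow : ∀ {μ ts m} (kids : Children μ ts m) → length (nodesBelow kids) ≡ m
    length-nodesBelow []          = refl
    length-nodesBelow (skip kids) = trans (length-map next (nodesBelow kids)) (length-nodesBelow kids)
    length-nodesBelow (child _ c kids) = trans (length-++ (List.map first (nodes c)))
      (cong₂ _+_ (trans (length-map first (nodes c)) (length-nodes c))
                 (trans (length-map next (nodesBelow kids)) (length-nodesBelow kids)))

  mutual
    unique-nodes : ∀ {s m} (c : ChainTree s m) → Unique (nodes c)
    unique-nodes (node _ _ _ _ _ kids) =
      All.map⁺ (All.universal (λ _ ()) (nodesBelow kids)) ∷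
      Unique.map⁺ cons-injective (unique-nodesBelow kids)

    unique-nodesBelow : ∀ {μ ts m} (kids : Children μ ts m) → Unique (nodesBelow kids)
    unique-nodesBelow []          = []
    unique-nodesBelow (skip kids) = Unique.map⁺ next-injective (unique-nodesBelow kids)
    unique-nodesBelow (child _ c kids) =
      Unique.++⁺ (Unique.map⁺ (cong proj₂) (unique-nodes c))
                 (Unique.map⁺ next-injective (unique-nodesBelow kids)) disjoint
      where
      disjoint : ∀ {v} → ¬ (v ∈ List.map first (nodes c) × v ∈ List.map next (nodesBelow kids))
      disjoint (v∈ , v∈′) with ∈-map⁻ _ v∈ | ∈-map⁻ _ v∈′
      ... | _ , _ , refl | _ , _ , ()

  mutual
    nodes-labelled : ∀ {s m} (c : ChainTree s m) → All (λ w → ∃[ a ] labelAt c w ≡ just a) (nodes c)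
    nodes-labelled (node _ _ _ _ _ kids) = (-, refl) ∷ All.map⁺ (nodesBelow-labelled kids)

    nodesBelow-labelled : ∀ {μ ts m} (kids : Children μ ts m) →
      All (λ (j , w) → ∃[ a ] labelBelow kids j w ≡ just a) (nodesBelow kids)
    nodesBelow-labelled []          = []
    nodesBelow-labelled (skip kids) = All.map⁺ (nodesBelow-labelled kids)
    nodesBelow-labelled (child _ c kids) =
      All.++⁺ (All.map⁺ (nodes-labelled c)) (All.map⁺ (nodesBelow-labelled kids))

-- Counting a list by classes.

total : ∀ {n} → (Fin n → ℕ) → ℕ
total {zero}  k = 0
total {suc n} k = k zero + total (k ∘ suc)

total-cong : ∀ {n} {k l : Fin n → ℕ} → (∀ i → k i ≡ l i) → total k ≡ total l
total-cong {zero}  eq = refl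
total-cong {suc n} eq = cong₂ _+_ (eq zero) (total-cong (eq ∘ suc))

total-suc : ∀ {n} {k l : Fin n → ℕ} i → l i ≡ suc (k i) → (∀ j → i ≢ j → l j ≡ k j) →
  total l ≡ suc (total k)
total-suc zero eq eqs = cong₂ _+_ eq (total-cong (λ j → eqs (suc j) λ ()))
total-suc {k = k} (suc i) eq eqs =
  trans (cong₂ _+_ (eqs zero λ ()) (total-suc i eq (λ j i≢j → eqs (suc j) (i≢j ∘ suc-injective))))
        (ℕ.+-suc (k zero) _)

module _ {A : Set} {n} (class : A → Maybe (Fin n)) where

  inClass? : ∀ c x → Dec (class x ≡ c)
  inClass? c x = Maybe.≡-dec Fin._≟_ (class x) c

  length-classes : ∀ xs → length xs ≡
    length (filter (inClass? nothing) xs) + total (λ i → length (filter (inClass? (just i)) xs))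
  length-classes [] = sym (total-zero n)
    where
    total-zero : ∀ n → total {n} (λ _ → 0) ≡ 0
    total-zero zero    = refl
    total-zero (suc n) = total-zero n
  length-classes (x ∷ xs) = trans (cong suc (length-classes xs)) (count (class x) refl)
    where
    size : Maybe (Fin n) → List A → ℕ
    size c ys = length (filter (inClass? c) ys)

    accept : ∀ {c} → class x ≡ c → size c (x ∷ xs) ≡ suc (size c xs)
    accept eq = cong length (filter-accept (inClass? _) eq)

    reject : ∀ {c} c′ → class x ≡ c → c ≢ c′ → size c′ (x ∷ xs) ≡ size c′ xs
    reject c′ eq c≢c′ = cong length (filter-reject (inClass? c′) (c≢c′ ∘ trans (sym eq)))

    count : ∀ c → class x ≡ c → suc (size nothing xs + total (λ i → size (just i) xs)) ≡
      size nothing (x ∷ xs) + total (λ i → size (just i) (x ∷ xs))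
    count nothing eq =
      sym (cong₂ _+_ (accept eq) (total-cong λ i → reject (just i) eq λ ()))
    count (just i) eq = trans (sym (ℕ.+-suc _ _)) (sym (cong₂ _+_ (reject nothing eq λ ())
      (total-suc i (accept eq) λ j i≢j → reject (just j) eq (i≢j ∘ just-injective))))

-- Finite parts of possibly infinite chain trees.

module TreeToFinite {𝔽 : FiniteSignature} {V : Set} (𝓡 : TRS 𝔽 V) where
  open Sharp 𝓡
  open DependencyTuples 𝓡
  open DT

  -- The alternative `n ≡ 0` is for targets that no selected node lies below; they become `skip`.
  Subtree : T.Subst → T.Term → ℕ → Set
  Subtree μ t n = n ≡ 0 ⊎ (∃[ m ] ∃[ s ] (n ≤ m × Star S._→ⁱ_ (t T.· μ) s × ChainTree s m))

  collect : ∀ {μ} ts (k : Fin (length ts) → ℕ) → (∀ i → Subtree μ (List.lookup ts i) (k i)) →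
    ∃[ m ] (total k ≤ m × Children μ ts m)
  collect []       k subs = 0 , z≤n , []
  collect (t ∷ ts) k subs with subs zero | collect ts (k ∘ suc) (subs ∘ suc)
  ... | inj₁ k≡0 | m , ≤m , kids = m , ℕ.≤-trans (ℕ.≤-reflexive (cong (_+ total (k ∘ suc)) k≡0)) ≤m ,
    skip kids
  ... | inj₂ (l , s , ≤l , sts , c) | m , ≤m , kids = l + m , ℕ.+-mono-≤ ≤l ≤m , child sts c kids

  unique-const : ∀ {A : Set} {x : A} {xs} → Unique xs → All (_≡ x) xs → length xs ≤ 1
  unique-const []                 _                   = z≤n
  unique-const (_ ∷ [])           _                   = s≤s z≤n
  unique-const ((x≢y ∷ _) ∷ _ ∷ _) (refl ∷ refl ∷ _) = contradiction refl x≢y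

  strip : ∀ {A : Set} {x : A} {xss : List (List A)} → All (λ xs → ∃[ ys ] xs ≡ x ∷ ys) xss →
    ∃[ yss ] xss ≡ List.map (x ∷_) yss
  strip []                = [] , refl
  strip ((ys , refl) ∷ h) with strip h
  ... | yss , refl = ys ∷ yss , refl

  module _ {T : Tree 𝓡} {s : T.Term} (isTree : IsChainTree 𝓡 (PDT 𝓡) T s) where
    open Tree T using (at; closed)
    open IsChainTree isTree

    Labelled : List ℕ → Set
    Labelled w = ∃[ a ] at w ≡ just a

    labelled-prefix : ∀ w u → Labelled (w ++ u) → Labelled w
    labelled-prefix w []      l = subst Labelled (++-identityʳ w) l
    labelled-prefix w (j ∷ u) l =
      closed w j (proj₂ (labelled-prefix (w ∷ʳ j) u (subst Labelled (sym (∷ʳ-++ w j u)) l)))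

    -- D bounds the depth of the selected nodes, so only finitely much of T is visited.
    prune : ∀ D w {d μ} → at w ≡ just (d , μ) → ∀ us → Unique us →
      All (λ u → Labelled (w ++ u)) us → All (λ u → length u ≤ D) us →
      ∃[ m ] (length us ≤ m × ChainTree (source d T.· μ) m)
    prune D w {d} {μ} e us uniq labelled short =
      let m , ≤m , kids = collect (targets d) (λ i → length (bucket (just i))) subtree
      in suc m ,
         ℕ.≤-trans (ℕ.≤-reflexive (length-classes class us)) (ℕ.+-mono-≤ atRoot ≤m) ,
         node d μ refl (labels w e) (normal w e) kids
      where
      ι : ∀ j {p δ} → at (w ∷ʳ j) ≡ just (p , δ) → Fin (length (targets d))
      ι = proj₁ (children w e)

      -- The label is abstracted together with its equation, since `ι` takes the proof that the
      -- child exists.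
      childClass : ∀ j a → at (w ∷ʳ j) ≡ a → Maybe (Fin (length (targets d)))
      childClass j (just _) eq = just (ι j eq)
      -- A default value: by prefix closure it never applies to a selected node.
      childClass j nothing  _  = nothing

      -- `just i` collects the paths through the child at target `i`, `nothing` the empty path to
      -- the node itself.
      class : List ℕ → Maybe (Fin (length (targets d)))
      class []      = nothing
      class (j ∷ _) = childClass j _ refl

      bucket : Maybe (Fin (length (targets d))) → List (List ℕ)
      bucket c = filter (inClass? class c) us

      childClass-just : ∀ {i} j a (eq : at (w ∷ʳ j) ≡ a) → childClass j a eq ≡ just i →
        ∃[ p ] ∃[ δ ] Σ (at (w ∷ʳ j) ≡ just (p , δ)) λ e′ → ι j e′ ≡ i
      childClass-just j (just (p , δ)) eq refl = p , δ , eq , refl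

      childClass-nothing : ∀ j a (eq : at (w ∷ʳ j) ≡ a) → childClass j a eq ≡ nothing →
        ¬ Labelled (w ∷ʳ j)
      childClass-nothing j nothing eq _ (_ , eq′) = contradiction (trans (sym eq′) eq) λ ()

      class-just : ∀ {i} u → class u ≡ just i →
        ∃[ j ] ∃[ v ] ∃[ p ] ∃[ δ ] Σ (at (w ∷ʳ j) ≡ just (p , δ)) λ e′ → u ≡ j ∷ v × ι j e′ ≡ i
      class-just (j ∷ v) eq =
        let p , δ , e′ , ι≡ = childClass-just j _ refl eq in j , v , p , δ , e′ , refl , ι≡

      class-nothing : ∀ u → class u ≡ nothing × Labelled (w ++ u) → u ≡ []
      class-nothing []      _        = refl
      class-nothing (j ∷ u) (eq , l) = contradiction
        (labelled-prefix (w ∷ʳ j) u (subst Labelled (sym (∷ʳ-++ w j u)) l))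
        (childClass-nothing j _ refl eq)

      descend : ∀ j {p δ} (e′ : at (w ∷ʳ j) ≡ just (p , δ)) us →
        (∃[ vs ] us ≡ List.map (j ∷_) vs) →
        Unique us → All (λ u → Labelled (w ++ u)) us → All (λ u → length u ≤ D) us →
        Subtree μ (List.lookup (targets d) (ι j e′)) (length us)
      descend j e′ _ ([]     , refl) _    _        _            = inj₁ refl
      -- The bound `D` on the length of `j ∷ v` must be a successor, and the recursion uses its
      -- predecessor.
      descend j e′ _ (v ∷ vs , refl) uniq labelled (s≤s le ∷ short)
        with prune _ (w ∷ʳ j) e′ (v ∷ vs) (Unique.map⁻ uniq)
          (All.map (λ {u} → subst Labelled (sym (∷ʳ-++ w j u))) (All.map⁻ labelled))
          (le ∷ All.map s≤s⁻¹ (All.map⁻ short))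
      ... | m , ≤m , c = inj₂ (m , -, ℕ.≤-trans (s≤s (ℕ.≤-reflexive (length-map (j ∷_) vs))) ≤m ,
        proj₂ (proj₂ (children w e)) j e′ , c)

      subtree : ∀ i → Subtree μ (List.lookup (targets d) i) (length (bucket (just i)))
      subtree i = subtreeFrom (bucket (just i))
        (Unique.filter⁺ (inClass? class (just i)) uniq)
        (All.all-filter (inClass? class (just i)) us)
        (All.filter⁺ (inClass? class (just i)) labelled)
        (All.filter⁺ (inClass? class (just i)) short)
        where
        subtreeFrom : ∀ us → Unique us → All (λ u → class u ≡ just i) us →
          All (λ u → Labelled (w ++ u)) us → All (λ u → length u ≤ D) us →
          Subtree μ (List.lookup (targets d) i) (length us)
        subtreeFrom []       _ _ _ _ = inj₁ refl
        subtreeFrom (u ∷ us) uniq classes@(c ∷ _) labelled short with class-just u c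
        ... | j , _ , _ , _ , e′ , _ , refl =
          descend j e′ (u ∷ us) (strip (All.map sameChild classes)) uniq labelled short
          where
          -- By injectivity of `ι`, all paths in one bucket pass through the same child `j`.
          sameChild : ∀ {u} → class u ≡ just (ι j e′) → ∃[ v ] u ≡ j ∷ v
          sameChild {u} eq =
            let j′ , v , _ , _ , e″ , u≡ , ι≡ = class-just u eq
            in v , trans u≡ (cong (λ j → j ∷ v) (proj₁ (proj₂ (children w e)) j′ j e″ e′ ι≡))

      atRoot : length (bucket nothing) ≤ 1
      atRoot = unique-const (Unique.filter⁺ (inClass? class nothing) uniq)
        (All.zipWith (λ {u} → class-nothing u)
          (All.all-filter (inClass? class nothing) us , All.filter⁺ (inClass? class nothing) labelled))

    finiteSubtree : ∀ ws → Unique ws → All Labelled ws → ∃[ m ] (length ws ≤ m × ChainTree s m)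
    finiteSubtree ws unique labelled =
      let d , σ , eq , s≡ = startsAt
          D , ≤D = lengths-bounded ws
          m , ≤m , c = prune D [] eq ws unique labelled ≤D
      in m , ≤m , subst (λ s → ChainTree s m) (sym s≡) c
      where
      lengths-bounded : ∀ ws → ∃[ D ] All (λ w → length w ≤ D) ws
      lengths-bounded []       = 0 , []
      lengths-bounded (w ∷ ws) =
        let D , ≤D = lengths-bounded ws
        in length w ⊔ D , ℕ.m≤m⊔n _ D ∷ All.map (λ le → ℕ.≤-trans le (ℕ.m≤n⊔m (length w) D)) ≤D

-- The two inequalities.

module _ {𝔽 : FiniteSignature} {V : Set} (𝓡 : TRS 𝔽 V) where
  open FiniteSignature 𝔽
  open Terms signature V
  open TRS 𝓡
  open Rewriting rules
  open TermProperties signature V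
  open Sharp 𝓡
  open RewritingProperties rules nonVar
  open ParallelTime signature V rules nonVar
  open Synchronisation signature V rules nonVar
  open DependencyTuples 𝓡
  open MaximalChains 𝓡
  open FiniteToTree 𝓡
  open TreeToFinite 𝓡

  constructorTerm-nf : ∀ {t} → ConstructorTerm 𝓡 t → NF t
  constructorTerm-nf (var x) = nf-var
  constructorTerm-nf (fun ¬d cs) =
    nf-fun (λ { (_ , _ , ∈R , _ , eq) → ¬d (root-defined ∈R eq) }) (λ i → constructorTerm-nf (cs i))

  ≤ω-trans : ∀ {a b c} → a ≤ω b → b ≤ω c → a ≤ω c
  ≤ω-trans = ≤⁺-trans ℕ.≤-trans

  ≤ω-stable : ∀ {a b} → ¬ ¬ a ≤ω b → a ≤ω b
  ≤ω-stable = decidable-stable (≤⁺-dec ℕ._≤?_ _ _)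

  0≤ω : ∀ c → [ 0 ] ≤ω c
  0≤ω ⊤⁺    = _ ≤⊤⁺
  0≤ω [ _ ] = [ z≤n ]

  nodes-pdt : ∀ {s m} (tr : ChainTree s m) →
    All (λ w → ∃[ d ] ∃[ μ ] (labelAt tr w ≡ just (d , μ) × PDT 𝓡 d)) (nodes tr)
  nodes-pdt tr = All.map (λ { {w} ((d , μ) , eq) → d , μ , eq , proj₁ (nodeAt tr w eq) })
    (nodes-labelled tr)

  pirc≤irc : ∀ n p c → IsPirc 𝓡 n p → IsIrc 𝓡 (canonical 𝓡) n c → p ≤ω c
  pirc≤irc n p c (_ , p-least) (c-bound , _) = p-least c λ where
    v (_ , basic@(f , ss , d , cs , refl) , size≤ , _ , v-least) → v-least c λ where
      -- A basic term in normal form may lack a chain tree, so length 0 is settled separately.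
      _ (zero    , _ , _     , refl) → 0≤ω c
      _ (e@(suc _) , _ , power , refl) → ≤ω-stable do
        k , k-cplx ← ¬¬sup-exists _
        let nfs = λ i → constructorTerm-nf (cs i)
            m , e≤m , tr = takes⇒chainTree d nfs (power⇒takes power) (s≤s z≤n)
        v , v-count ← ¬¬sup-exists _
        let m≤v = proj₁ v-count _ (nodes tr , unique-nodes tr , nodes-pdt tr , refl)
            v≤k = proj₁ k-cplx v (tree tr , isChainTree tr , v-count)
            k≤c = c-bound k (_ , basic , size≤ , k-cplx)
        pure (≤ω-trans [ ℕ.≤-trans e≤m (ℕ.≤-reflexive (sym (length-nodes tr))) ]
          (≤ω-trans m≤v (≤ω-trans v≤k k≤c)))

  -- Unfolding the suprema leaves a finite set `ws` of nodes in one possibly infinite tree. A finite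
  -- chain tree with at least as many nodes replaces it and is turned into a derivation.
  irc≤pirc : Confluent _⇉_ → ∀ n p c → IsPirc 𝓡 n p → IsIrc 𝓡 (canonical 𝓡) n c → c ≤ω p
  irc≤pirc confluent n p c (p-bound , _) (_ , c-least) = c-least p λ where
    _ (_ , basic@(f , ss , d , cs , refl) , size≤ , _ , k-least) → k-least p λ where
      _ (T , isTree , _ , v-least) → v-least p λ where
        _ (ws , unique , labelled , refl) → ≤ω-stable do
          h , h-dh ← ¬¬sup-exists _
          let m , ws≤m , tr = finiteSubtree isTree ws unique
                (All.map (λ (_ , _ , eq , _) → -, eq) labelled)
              nfs , _ , _ , _ , _ , m≡ , ∈R , eq , t = chainTree⇒takes tr (♯-defined d)
          -- The arguments of the basic term are already normal, so the root step needs no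
          -- evaluation before it and nothing is counted below it.
          _ , _ , b≤e , power ← takes⇒power confluent (root (λ _ → ε) nfs ∈R eq none t)
          let e≤h = proj₁ h-dh _ (-, -, power , refl)
              h≤p = p-bound h (_ , basic , size≤ , h-dh)
          pure (≤ω-trans [ ℕ.≤-trans ws≤m (ℕ.≤-trans (ℕ.≤-reflexive m≡) b≤e) ] (≤ω-trans e≤h h≤p))

theorem4p13 : (𝔽 : FiniteSignature) (V : Set) (𝓡 : TRS 𝔽 V) →
    (∀ (n : ℕ) (p c : ℕω) → IsPirc 𝓡 n p → IsIrc 𝓡 (canonical 𝓡) n c → p ≤ω c)
    × (Confluent (_⇉ᴿ_ 𝓡) →
    ∀ (n : ℕ) (p c : ℕω) → IsPirc 𝓡 n p → IsIrc 𝓡 (canonical 𝓡) n c → p ≡ c)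
theorem4p13 𝔽 V 𝓡 = pirc≤irc 𝓡 , λ confluent n p c isPirc isIrc →
  ≤⁺-antisym-≡ ℕ.≤-antisym (pirc≤irc 𝓡 n p c isPirc isIrc) (irc≤pirc 𝓡 confluent n p c isPirc isIrc)
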